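{- Summing over partitions into even parts, $$\frac{\pi}{2}=\sum_{\lambda\in\mathcal P_{2\mathbb Z}}\frac{1}{n_\lambda^2}.$$
   Context: A partition is a finite non-increasing sequence $\lambda=(\lambda_1,\dots,\lambda_r)$ of positive integers, including the empty partition $\emptyset$ ($r=0$). $\mathcal P_{2\mathbb Z}$ is the set of partitions all of whose parts are even (including $\emptyset$). The integer of $\lambda$ is the product of its parts $n_\lambda:=\lambda_1\lambda_2\cdots\lambda_r$, with $n_\emptyset:=1$. -}

module Defs where

open import Data.Bool.Base using (Bool; true; false; if_then_else_; T)
open import Data.Integer.Base as ℤ using (+_; +[1+_]; -[1+_])
import Data.Integer.Properties as ℤ
open import Data.List.Base as List using (List; []; _∷_; applyUpTo)
open import Data.List.Relation.Binary.Subset.Propositional using (_⊆_)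
open import Data.List.Relation.Unary.All using (All)
open import Data.List.Relation.Unary.Linked using (Linked)
open import Data.List.Relation.Unary.Unique.Propositional using (Unique)
open import Data.Nat.Base as ℕ using (ℕ; zero; suc; NonZero; z≤n; s≤s)
open import Data.Nat.Divisibility using (_∣_; ∣-refl)
import Data.Nat.DivMod as ℕ
open import Data.Nat.ListAction using (sum; product)
open import Data.Nat.ListAction.Properties using (product≢0)
import Data.Nat.Properties as ℕ
open import Data.Nat.Solver using () renaming (module +-*-Solver to ℕSolver)
open import Data.Product.Base using (∃-syntax; _×_; _,_)
open import Data.Rational as ℚ using (ℚ; mkℚ; 0ℚ; 1ℚ; ½; toℚᵘ; *<*)
import Data.Rational.Properties as ℚ
open import Data.Rational.Solver using () renaming (module +-*-Solver to ℚSolver)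
import Data.Rational.Unnormalised as ℚᵘ
import Data.Rational.Unnormalised.Properties as ℚᵘ
open import Data.Refinement using (Refinement-syntax)
open import Data.Sum.Base using (inj₁; inj₂)
open import Function.Base using (_∘_)
open import Relation.Binary.PropositionalEquality

abs-intro : ∀ x y {ε} → x ℚ.≤ y ℚ.+ ε → y ℚ.≤ x ℚ.+ ε → ℚ.∣ x ℚ.- y ∣ ℚ.≤ ε
abs-intro x y {ε} x≤y+ε y≤x+ε with ℚ.∣p∣≡p∨∣p∣≡-p (x ℚ.- y)
... | inj₁ eq = begin
  ℚ.∣ x ℚ.- y ∣       ≡⟨ eq ⟩
  x ℚ.- y             ≤⟨ ℚ.+-monoˡ-≤ (ℚ.- y) x≤y+ε ⟩
  (y ℚ.+ ε) ℚ.- y     ≡⟨ solve 2 (λ y ε → (y :+ ε) :- y := ε) refl y ε ⟩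
  ε                   ∎
  where open ℚ.≤-Reasoning
        open ℚSolver
... | inj₂ eq = begin
  ℚ.∣ x ℚ.- y ∣       ≡⟨ eq ⟩
  ℚ.- (x ℚ.- y)       ≡⟨ solve 2 (λ x y → :- (x :- y) := y :- x) refl x y ⟩
  y ℚ.- x             ≤⟨ ℚ.+-monoˡ-≤ (ℚ.- x) y≤x+ε ⟩
  (x ℚ.+ ε) ℚ.- x     ≡⟨ solve 2 (λ x ε → (x :+ ε) :- x := ε) refl x ε ⟩
  ε                   ∎
  where open ℚ.≤-Reasoning
        open ℚSolver

∣∣-step : ∀ x y → ℚ.∣ x ∣ ℚ.≤ ℚ.∣ y ∣ ℚ.+ ℚ.∣ x ℚ.- y ∣
∣∣-step x y = begin
  ℚ.∣ x ∣                     ≡⟨ cong ℚ.∣_∣ (solve 2 (λ x y → x := y :+ (x :- y)) refl x y) ⟩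
  ℚ.∣ y ℚ.+ (x ℚ.- y) ∣       ≤⟨ ℚ.∣p+q∣≤∣p∣+∣q∣ y (x ℚ.- y) ⟩
  ℚ.∣ y ∣ ℚ.+ ℚ.∣ x ℚ.- y ∣   ∎
  where open ℚ.≤-Reasoning
        open ℚSolver

∣-∣-comm : ∀ x y → ℚ.∣ x ℚ.- y ∣ ≡ ℚ.∣ y ℚ.- x ∣
∣-∣-comm x y = trans (sym (ℚ.∣-p∣≡∣p∣ (x ℚ.- y)))
  (cong ℚ.∣_∣ (solve 2 (λ x y → :- (x :- y) := y :- x) refl x y))
  where open ℚSolver

∣∣-lipschitz : ∀ x y → ℚ.∣ ℚ.∣ x ∣ ℚ.- ℚ.∣ y ∣ ∣ ℚ.≤ ℚ.∣ x ℚ.- y ∣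
∣∣-lipschitz x y = abs-intro ℚ.∣ x ∣ ℚ.∣ y ∣ (∣∣-step x y)
  (subst (λ d → ℚ.∣ y ∣ ℚ.≤ ℚ.∣ x ∣ ℚ.+ d) (∣-∣-comm y x) (∣∣-step y x))

0<1 : 0ℚ ℚ.< 1ℚ
0<1 = *<* (ℤ.+<+ (s≤s z≤n))

half-pos : ∀ {ε} → 0ℚ ℚ.< ε → 0ℚ ℚ.< ½ ℚ.* ε
half-pos = ℚ.*-monoʳ-<-pos ½

halves : ∀ ε → ½ ℚ.* ε ℚ.+ ½ ℚ.* ε ≡ ε
halves ε = trans (sym (ℚ.*-distribʳ-+ ε ½ ½)) (ℚ.*-identityˡ ε)

/-mono : ∀ a b c d .{{_ : NonZero b}} .{{_ : NonZero d}} →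
         a ℕ.* d ℕ.≤ c ℕ.* b → (+ a) ℚ./ b ℚ.≤ (+ c) ℚ./ d
/-mono a b@(suc _) c d@(suc _) le = ℚ.toℚᵘ-cancel-≤ (begin
  toℚᵘ (+ a ℚ./ b)   ≃⟨ ℚ.toℚᵘ-fromℚᵘ (+ a ℚᵘ./ b) ⟩
  + a ℚᵘ./ b         ≤⟨ ℚᵘ.*≤* (subst₂ ℤ._≤_ (ℤ.pos-* a d) (ℤ.pos-* c b) (ℤ.+≤+ le)) ⟩
  + c ℚᵘ./ d         ≃⟨ ℚ.toℚᵘ-fromℚᵘ (+ c ℚᵘ./ d) ⟨
  toℚᵘ (+ c ℚ./ d)   ∎)
  where open ℚᵘ.≤-Reasoning

/-+ : ∀ a c b .{{_ : NonZero b}} →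
      (+ (a ℕ.+ c)) ℚ./ b ≡ (+ a) ℚ./ b ℚ.+ (+ c) ℚ./ b
/-+ a c b@(suc _) = ℚ.toℚᵘ-injective (begin-equality
  toℚᵘ (+ (a ℕ.+ c) ℚ./ b)                   ≃⟨ ℚ.toℚᵘ-fromℚᵘ (+ (a ℕ.+ c) ℚᵘ./ b) ⟩
  + (a ℕ.+ c) ℚᵘ./ b                         ≃⟨ ℚᵘ.*≡* eq ⟩
  + a ℚᵘ./ b ℚᵘ.+ + c ℚᵘ./ b                 ≃⟨ ℚᵘ.+-cong (ℚ.toℚᵘ-fromℚᵘ (+ a ℚᵘ./ b)) (ℚ.toℚᵘ-fromℚᵘ (+ c ℚᵘ./ b)) ⟨
  toℚᵘ (+ a ℚ./ b) ℚᵘ.+ toℚᵘ (+ c ℚ./ b)     ≃⟨ ℚ.toℚᵘ-homo-+ (+ a ℚ./ b) (+ c ℚ./ b) ⟨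
  toℚᵘ (+ a ℚ./ b ℚ.+ + c ℚ./ b)             ∎)
  where
  open ℚᵘ.≤-Reasoning
  eq : + (a ℕ.+ c) ℤ.* + (b ℕ.* b) ≡ (+ a ℤ.* + b ℤ.+ + c ℤ.* + b) ℤ.* + b
  eq = trans (cong₂ ℤ._*_ (ℤ.pos-+ a c) (ℤ.pos-* b b))
       (trans (sym (ℤ.*-assoc (+ a ℤ.+ + c) (+ b) (+ b)))
              (cong (ℤ._* + b) (ℤ.*-distribʳ-+ (+ b) (+ a) (+ c))))

-- Real numbers are Cauchy sequences of rationals. Two such sequences denote
-- the same real number when they are _≃ᵣ_-related.

record ℝ : Set where
  constructor mkℝ
  field
    seq    : ℕ → ℚ
    cauchy : ∀ ε → 0ℚ ℚ.< ε →
             ∃[ N ] (∀ m n → N ℕ.≤ m → N ℕ.≤ n → ℚ.∣ seq m ℚ.- seq n ∣ ℚ.≤ ε)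

open ℝ public

infix  4 _≤ᵣ_ _≃ᵣ_
infixl 6 _+ᵣ_ _-ᵣ_
infixr 7 _·ᵣ_
infix  8 -ᵣ_

_≤ᵣ_ : ℝ → ℝ → Set
x ≤ᵣ y = ∀ ε → 0ℚ ℚ.< ε → ∃[ N ] (∀ n → N ℕ.≤ n → seq x n ℚ.≤ seq y n ℚ.+ ε)

_≃ᵣ_ : ℝ → ℝ → Set
x ≃ᵣ y = x ≤ᵣ y × y ≤ᵣ x

fromℚ : ℚ → ℝ
fromℚ q .seq n        = q
fromℚ q .cauchy ε 0<ε = 0 , λ _ _ _ _ →
  subst (ℚ._≤ ε) (cong ℚ.∣_∣ (sym (ℚ.+-inverseʳ q))) (ℚ.<⇒≤ 0<ε)

_+ᵣ_ : ℝ → ℝ → ℝ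
(x +ᵣ y) .seq n = seq x n ℚ.+ seq y n
(x +ᵣ y) .cauchy ε 0<ε
  with cauchy x (½ ℚ.* ε) (half-pos 0<ε) | cauchy y (½ ℚ.* ε) (half-pos 0<ε)
... | M , hx | N , hy = M ℕ.⊔ N , λ m n p q → let
      open ℚ.≤-Reasoning
      open ℚSolver
      a = seq x m; b = seq y m; c = seq x n; d = seq y n
    in begin
      ℚ.∣ (a ℚ.+ b) ℚ.- (c ℚ.+ d) ∣
        ≡⟨ cong ℚ.∣_∣ (solve 4 (λ a b c d → (a :+ b) :- (c :+ d) := (a :- c) :+ (b :- d)) refl a b c d) ⟩
      ℚ.∣ (a ℚ.- c) ℚ.+ (b ℚ.- d) ∣
        ≤⟨ ℚ.∣p+q∣≤∣p∣+∣q∣ (a ℚ.- c) (b ℚ.- d) ⟩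
      ℚ.∣ a ℚ.- c ∣ ℚ.+ ℚ.∣ b ℚ.- d ∣
        ≤⟨ ℚ.+-mono-≤ (hx m n (ℕ.m⊔n≤o⇒m≤o M N p) (ℕ.m⊔n≤o⇒m≤o M N q))
                      (hy m n (ℕ.m⊔n≤o⇒n≤o M N p) (ℕ.m⊔n≤o⇒n≤o M N q)) ⟩
      ½ ℚ.* ε ℚ.+ ½ ℚ.* ε
        ≡⟨ halves ε ⟩
      ε ∎

-ᵣ_ : ℝ → ℝ
(-ᵣ x) .seq n = ℚ.- seq x n
(-ᵣ x) .cauchy ε 0<ε with cauchy x ε 0<ε
... | N , h = N , λ m n p q → let open ℚSolver in
  subst (ℚ._≤ ε)
    (cong ℚ.∣_∣ (solve 2 (λ a b → b :- a := (:- a) :- (:- b)) refl (seq x m) (seq x n)))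
    (h n m q p)

_-ᵣ_ : ℝ → ℝ → ℝ
x -ᵣ y = x +ᵣ (-ᵣ y)

∣_∣ᵣ : ℝ → ℝ
∣ x ∣ᵣ .seq n = ℚ.∣ seq x n ∣
∣ x ∣ᵣ .cauchy ε 0<ε with cauchy x ε 0<ε
... | N , h = N , λ m n p q → ℚ.≤-trans (∣∣-lipschitz (seq x m) (seq x n)) (h m n p q)

module Scale (r ε : ℚ) (0<ε : 0ℚ ℚ.< ε) where
  K : ℚ
  K = 1ℚ ℚ.+ ℚ.∣ r ∣

  instance
    K-pos : ℚ.Positive K
    K-pos = ℚ.positive (ℚ.+-mono-<-≤ {0ℚ} {1ℚ} {0ℚ} {ℚ.∣ r ∣} 0<1 (ℚ.0≤∣p∣ r))

    K-nonZero : ℚ.NonZero K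
    K-nonZero = ℚ.pos⇒nonZero K

    K⁻¹-pos : ℚ.Positive (ℚ.1/ K)
    K⁻¹-pos = ℚ.1/pos⇒pos K

  δ : ℚ
  δ = ℚ.1/ K ℚ.* ε

  0<δ : 0ℚ ℚ.< δ
  0<δ = subst (ℚ._< δ) (ℚ.*-zeroʳ (ℚ.1/ K)) (ℚ.*-monoʳ-<-pos (ℚ.1/ K) 0<ε)

  bound : ∀ x y → ℚ.∣ x ℚ.- y ∣ ℚ.≤ δ → ℚ.∣ r ℚ.* x ℚ.- r ℚ.* y ∣ ℚ.≤ ε
  bound x y h = begin
    ℚ.∣ r ℚ.* x ℚ.- r ℚ.* y ∣
      ≡⟨ cong ℚ.∣_∣ (solve 3 (λ r x y → r :* x :- r :* y := r :* (x :- y)) refl r x y) ⟩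
    ℚ.∣ r ℚ.* (x ℚ.- y) ∣
      ≡⟨ ℚ.∣p*q∣≡∣p∣*∣q∣ r (x ℚ.- y) ⟩
    ℚ.∣ r ∣ ℚ.* ℚ.∣ x ℚ.- y ∣
      ≤⟨ ℚ.*-monoʳ-≤-nonNeg ℚ.∣ x ℚ.- y ∣ {{ℚ.∣-∣-nonNeg (x ℚ.- y)}} ∣r∣≤K ⟩
    K ℚ.* ℚ.∣ x ℚ.- y ∣
      ≤⟨ ℚ.*-monoˡ-≤-nonNeg K {{ℚ.pos⇒nonNeg K}} h ⟩
    K ℚ.* (ℚ.1/ K ℚ.* ε)
      ≡⟨ ℚ.*-assoc K (ℚ.1/ K) ε ⟨
    K ℚ.* ℚ.1/ K ℚ.* ε
      ≡⟨ cong (ℚ._* ε) (ℚ.*-inverseʳ K) ⟩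
    1ℚ ℚ.* ε
      ≡⟨ ℚ.*-identityˡ ε ⟩
    ε ∎
    where
    open ℚ.≤-Reasoning
    open ℚSolver
    ∣r∣≤K : ℚ.∣ r ∣ ℚ.≤ K
    ∣r∣≤K = subst (ℚ._≤ K) (ℚ.+-identityˡ ℚ.∣ r ∣)
      (ℚ.+-monoˡ-≤ ℚ.∣ r ∣ {0ℚ} {1ℚ} (ℚ.<⇒≤ 0<1))

_·ᵣ_ : ℚ → ℝ → ℝ
(r ·ᵣ x) .seq n = r ℚ.* seq x n
(r ·ᵣ x) .cauchy ε 0<ε with cauchy x (Scale.δ r ε 0<ε) (Scale.0<δ r ε 0<ε)
... | N , h = N , λ m n p q → Scale.bound r ε 0<ε (seq x m) (seq x n) (h m n p q)

sumᵣ : List ℝ → ℝ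
sumᵣ = List.foldr _+ᵣ_ (fromℚ 0ℚ)

-- Unordered summation: the sums over finite subsets of I, directed by
-- inclusion, converge to s. A finite subset is a duplicate-free list; for
-- S only the set of its elements matters.

HasSum : ∀ {i} {I : Set i} → (I → ℝ) → ℝ → Set i
HasSum {I = I} f s =
  ∀ ε → 0ℚ ℚ.< ε →
  ∃[ S ] (∀ (T : List I) → Unique T → S ⊆ T →
          ∣ sumᵣ (List.map f T) -ᵣ s ∣ᵣ ≤ᵣ fromℚ ε)

∑< : ℕ → (ℕ → ℕ) → ℕ
∑< n f = sum (applyUpTo f n)

infix 5 [_≤_]

[_≤_] : ℕ → ℕ → ℕ
[ m ≤ n ] = if m ℕ.≤ᵇ n then 1 else 0

-- Divide [0,1]² into k² squares of side 1/k, the square (i , j) being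
-- [i/k , (i+1)/k] × [j/k , (j+1)/k]. The number inner k counts the squares
-- contained in the disc x² + y² ≤ 1, i.e. whose far corner lies in it, and
-- outer k those whose interior meets it, i.e. whose near corner lies in the
-- open disc.

inner : ℕ → ℕ
inner k = ∑< k λ i → ∑< k λ j → [ suc i ℕ.* suc i ℕ.+ suc j ℕ.* suc j ≤ k ℕ.* k ]

outer : ℕ → ℕ
outer k = ∑< k λ i → ∑< k λ j → [ suc (i ℕ.* i ℕ.+ j ℕ.* j) ≤ k ℕ.* k ]

[≤]-mono : ∀ {a b c d} → (a ℕ.≤ b → c ℕ.≤ d) → [ a ≤ b ] ℕ.≤ [ c ≤ d ]
[≤]-mono {a} {b} {c} {d} imp
  with a ℕ.≤ᵇ b in eq₁ | c ℕ.≤ᵇ d in eq₂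
... | false | _     = z≤n
... | true  | true  = s≤s z≤n
... | true  | false with () ← subst T eq₂ (ℕ.≤⇒≤ᵇ (imp (ℕ.≤ᵇ⇒≤ a b (subst T (sym eq₁) _))))

[≤]≤1 : ∀ a b → [ a ≤ b ] ℕ.≤ 1
[≤]≤1 a b with a ℕ.≤ᵇ b
... | false = z≤n
... | true  = s≤s z≤n

∑-mono : ∀ n {f g} → (∀ i → i ℕ.< n → f i ℕ.≤ g i) → ∑< n f ℕ.≤ ∑< n g
∑-mono zero    h = z≤n
∑-mono (suc n) h = ℕ.+-mono-≤ (h 0 (s≤s z≤n)) (∑-mono n (λ i i<n → h (suc i) (s≤s i<n)))

∑-cong : ∀ n {f g} → (∀ i → f i ≡ g i) → ∑< n f ≡ ∑< n g
∑-cong zero    h = refl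
∑-cong (suc n) h = cong₂ ℕ._+_ (h 0) (∑-cong n (h ∘ suc))

∑-++ : ∀ m n f → ∑< (m ℕ.+ n) f ≡ ∑< m f ℕ.+ ∑< n (λ i → f (m ℕ.+ i))
∑-++ zero    n f = refl
∑-++ (suc m) n f = trans (cong (f 0 ℕ.+_) (∑-++ m n (f ∘ suc)))
                         (sym (ℕ.+-assoc (f 0) (∑< m (f ∘ suc)) _))

∑-last : ∀ n f → ∑< (suc n) f ≡ ∑< n f ℕ.+ f n
∑-last n f = begin
  ∑< (suc n) f                       ≡⟨ cong (λ k → ∑< k f) (ℕ.+-comm 1 n) ⟩
  ∑< (n ℕ.+ 1) f                     ≡⟨ ∑-++ n 1 f ⟩
  ∑< n f ℕ.+ (f (n ℕ.+ 0) ℕ.+ 0)     ≡⟨ cong (∑< n f ℕ.+_) (ℕ.+-identityʳ _) ⟩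
  ∑< n f ℕ.+ f (n ℕ.+ 0)             ≡⟨ cong (λ k → ∑< n f ℕ.+ f k) (ℕ.+-identityʳ n) ⟩
  ∑< n f ℕ.+ f n                     ∎
  where open ≡-Reasoning

∑-+ : ∀ n f g → ∑< n (λ i → f i ℕ.+ g i) ≡ ∑< n f ℕ.+ ∑< n g
∑-+ zero    f g = refl
∑-+ (suc n) f g = trans (cong (f 0 ℕ.+ g 0 ℕ.+_) (∑-+ n (f ∘ suc) (g ∘ suc)))
  (solve 4 (λ a b c d → a :+ b :+ (c :+ d) := a :+ c :+ (b :+ d)) refl
     (f 0) (g 0) (∑< n (f ∘ suc)) (∑< n (g ∘ suc)))
  where open ℕSolver

∑-const : ∀ n c → ∑< n (λ _ → c) ≡ n ℕ.* c
∑-const zero    c = refl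
∑-const (suc n) c = cong (c ℕ.+_) (∑-const n c)

∑-*ˡ : ∀ n c f → ∑< n (λ i → c ℕ.* f i) ≡ c ℕ.* ∑< n f
∑-*ˡ zero    c f = sym (ℕ.*-zeroʳ c)
∑-*ˡ (suc n) c f = trans (cong (c ℕ.* f 0 ℕ.+_) (∑-*ˡ n c (f ∘ suc)))
                         (sym (ℕ.*-distribˡ-+ c (f 0) _))

∑-block : ∀ m n .{{_ : NonZero n}} f → ∑< (m ℕ.* n) (λ x → f (x ℕ./ n)) ≡ n ℕ.* ∑< m f
∑-block zero    n f = sym (ℕ.*-zeroʳ n)
∑-block (suc m) n f = begin
  ∑< (n ℕ.+ m ℕ.* n) (λ x → f (x ℕ./ n))
    ≡⟨ ∑-++ n (m ℕ.* n) _ ⟩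
  ∑< n (λ x → f (x ℕ./ n)) ℕ.+ ∑< (m ℕ.* n) (λ x → f ((n ℕ.+ x) ℕ./ n))
    ≡⟨ cong₂ ℕ._+_ (first n ℕ.≤-refl) (∑-cong (m ℕ.* n) (λ x → cong f (shift x))) ⟩
  n ℕ.* f 0 ℕ.+ ∑< (m ℕ.* n) (λ x → f (suc (x ℕ./ n)))
    ≡⟨ cong (n ℕ.* f 0 ℕ.+_) (∑-block m n (f ∘ suc)) ⟩
  n ℕ.* f 0 ℕ.+ n ℕ.* ∑< m (f ∘ suc)
    ≡⟨ ℕ.*-distribˡ-+ n (f 0) _ ⟨
  n ℕ.* ∑< (suc m) f ∎
  where
  open ≡-Reasoning
  shift : ∀ x → (n ℕ.+ x) ℕ./ n ≡ suc (x ℕ./ n)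
  shift x = trans (ℕ.+-distrib-/-∣ˡ x ∣-refl)
                  (cong (ℕ._+ x ℕ./ n) (ℕ.n/n≡1 n))
  first : ∀ l → l ℕ.≤ n → ∑< l (λ x → f (x ℕ./ n)) ≡ l ℕ.* f 0
  first zero    _   = refl
  first (suc l) l<n = trans (∑-last l _)
    (trans (cong₂ ℕ._+_ (first l (ℕ.<⇒≤ l<n)) (cong f (ℕ.m<n⇒m/n≡0 l<n)))
           (ℕ.+-comm (l ℕ.* f 0) (f 0)))

∑-block₂ : ∀ m n .{{_ : NonZero n}} (f : ℕ → ℕ → ℕ) →
           ∑< (m ℕ.* n) (λ x → ∑< (m ℕ.* n) (λ y → f (x ℕ./ n) (y ℕ./ n)))
           ≡ (n ℕ.* n) ℕ.* ∑< m (λ i → ∑< m (f i))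
∑-block₂ m n f = begin
  ∑< (m ℕ.* n) (λ x → ∑< (m ℕ.* n) (λ y → f (x ℕ./ n) (y ℕ./ n)))
    ≡⟨ ∑-cong (m ℕ.* n) (λ x → ∑-block m n (f (x ℕ./ n))) ⟩
  ∑< (m ℕ.* n) (λ x → n ℕ.* ∑< m (f (x ℕ./ n)))
    ≡⟨ ∑-*ˡ (m ℕ.* n) n _ ⟩
  n ℕ.* ∑< (m ℕ.* n) (λ x → ∑< m (f (x ℕ./ n)))
    ≡⟨ cong (n ℕ.*_) (∑-block m n (λ i → ∑< m (f i))) ⟩
  n ℕ.* (n ℕ.* ∑< m (λ i → ∑< m (f i)))
    ≡⟨ ℕ.*-assoc n n _ ⟨
  (n ℕ.* n) ℕ.* ∑< m (λ i → ∑< m (f i)) ∎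
  where open ≡-Reasoning

<-block : ∀ x n .{{_ : NonZero n}} → x ℕ.< suc (x ℕ./ n) ℕ.* n
<-block x n = begin-strict
  x                                ≡⟨ ℕ.m≡m%n+[m/n]*n x n ⟩
  x ℕ.% n ℕ.+ x ℕ./ n ℕ.* n        <⟨ ℕ.+-monoˡ-< (x ℕ./ n ℕ.* n) (ℕ.m%n<n x n) ⟩
  n ℕ.+ x ℕ./ n ℕ.* n              ∎
  where open ℕ.≤-Reasoning

sq-* : ∀ a b n → (a ℕ.* n) ℕ.* (a ℕ.* n) ℕ.+ (b ℕ.* n) ℕ.* (b ℕ.* n)
                 ≡ (a ℕ.* a ℕ.+ b ℕ.* b) ℕ.* (n ℕ.* n)
sq-* = solve 3 (λ a b n → (a :* n) :* (a :* n) :+ (b :* n) :* (b :* n)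
                          := (a :* a :+ b :* b) :* (n :* n)) refl
  where open ℕSolver

refine : ∀ m n .{{_ : NonZero m}} .{{_ : NonZero n}} x y →
  suc (x ℕ./ n) ℕ.* suc (x ℕ./ n) ℕ.+ suc (y ℕ./ n) ℕ.* suc (y ℕ./ n) ℕ.≤ m ℕ.* m →
  suc (x ℕ./ m ℕ.* (x ℕ./ m) ℕ.+ y ℕ./ m ℕ.* (y ℕ./ m)) ℕ.≤ n ℕ.* n
refine m n x y h = ℕ.*-cancelʳ-< (m ℕ.* m) _ _ (begin-strict
  (c ℕ.* c ℕ.+ d ℕ.* d) ℕ.* (m ℕ.* m)
    ≡⟨ sq-* c d m ⟨
  (c ℕ.* m) ℕ.* (c ℕ.* m) ℕ.+ (d ℕ.* m) ℕ.* (d ℕ.* m)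
    ≤⟨ ℕ.+-mono-≤ (ℕ.*-mono-≤ (ℕ.m/n*n≤m x m) (ℕ.m/n*n≤m x m))
                  (ℕ.*-mono-≤ (ℕ.m/n*n≤m y m) (ℕ.m/n*n≤m y m)) ⟩
  x ℕ.* x ℕ.+ y ℕ.* y
    <⟨ ℕ.+-mono-<-≤ (ℕ.*-mono-< (<-block x n) (<-block x n))
                    (ℕ.*-mono-≤ (ℕ.<⇒≤ (<-block y n)) (ℕ.<⇒≤ (<-block y n))) ⟩
  (a ℕ.* n) ℕ.* (a ℕ.* n) ℕ.+ (b ℕ.* n) ℕ.* (b ℕ.* n)
    ≡⟨ sq-* a b n ⟩
  (a ℕ.* a ℕ.+ b ℕ.* b) ℕ.* (n ℕ.* n)
    ≤⟨ ℕ.*-monoˡ-≤ (n ℕ.* n) h ⟩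
  (m ℕ.* m) ℕ.* (n ℕ.* n)
    ≡⟨ ℕ.*-comm (m ℕ.* m) (n ℕ.* n) ⟩
  (n ℕ.* n) ℕ.* (m ℕ.* m) ∎)
  where
  open ℕ.≤-Reasoning
  a b c d : ℕ
  a = suc (x ℕ./ n)
  b = suc (y ℕ./ n)
  c = x ℕ./ m
  d = y ℕ./ m

-- inner m / m² ≤ outer n / n²

inner≤outer : ∀ m n .{{_ : NonZero m}} .{{_ : NonZero n}} →
              (n ℕ.* n) ℕ.* inner m ℕ.≤ (m ℕ.* m) ℕ.* outer n
inner≤outer m n = begin
  (n ℕ.* n) ℕ.* inner m
    ≡⟨ ∑-block₂ m n (λ i j → [ suc i ℕ.* suc i ℕ.+ suc j ℕ.* suc j ≤ m ℕ.* m ]) ⟨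
  ∑< (m ℕ.* n) (λ x → ∑< (m ℕ.* n) λ y →
      [ suc (x ℕ./ n) ℕ.* suc (x ℕ./ n) ℕ.+ suc (y ℕ./ n) ℕ.* suc (y ℕ./ n) ≤ m ℕ.* m ])
    ≤⟨ ∑-mono (m ℕ.* n) (λ x _ → ∑-mono (m ℕ.* n) (λ y _ → [≤]-mono (refine m n x y))) ⟩
  ∑< (m ℕ.* n) (λ x → ∑< (m ℕ.* n) (g x))
    ≡⟨ cong (λ k → ∑< k (λ x → ∑< k (g x))) (ℕ.*-comm m n) ⟩
  ∑< (n ℕ.* m) (λ x → ∑< (n ℕ.* m) (g x))
    ≡⟨ ∑-block₂ n m (λ i j → [ suc (i ℕ.* i ℕ.+ j ℕ.* j) ≤ n ℕ.* n ]) ⟩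
  (m ℕ.* m) ℕ.* outer n ∎
  where
  open ℕ.≤-Reasoning
  g : ℕ → ℕ → ℕ
  g x y = [ suc (x ℕ./ m ℕ.* (x ℕ./ m) ℕ.+ y ℕ./ m ℕ.* (y ℕ./ m)) ≤ n ℕ.* n ]

outer≤inner : ∀ k → outer k ℕ.≤ inner k ℕ.+ (k ℕ.+ k)
outer≤inner zero        = z≤n
outer≤inner k@(suc k-1) = begin
  ∑< k (o 0) ℕ.+ ∑< k-1 (λ i → o (suc i) 0 ℕ.+ ∑< k-1 (λ j → o (suc i) (suc j)))
    ≤⟨ ℕ.+-mono-≤ (ones k (o 0) (λ j → [≤]≤1 (suc (j ℕ.* j)) (k ℕ.* k)))
         (∑-mono k-1 (λ i _ → ℕ.+-mono-≤ ([≤]≤1 (suc (suc i ℕ.* suc i ℕ.+ 0)) (k ℕ.* k))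
           (∑-mono k-1 (λ j _ → [≤]-mono {suc (suc i ℕ.* suc i ℕ.+ suc j ℕ.* suc j)} {k ℕ.* k} ℕ.<⇒≤)))) ⟩
  k ℕ.+ ∑< k-1 (λ i → 1 ℕ.+ ∑< k-1 (ι i))
    ≡⟨ cong (k ℕ.+_) (∑-+ k-1 (λ _ → 1) (λ i → ∑< k-1 (ι i))) ⟩
  k ℕ.+ (∑< k-1 (λ _ → 1) ℕ.+ ∑< k-1 (λ i → ∑< k-1 (ι i)))
    ≤⟨ ℕ.+-monoʳ-≤ k (ℕ.+-mono-≤
         (ℕ.≤-trans (ones k-1 (λ _ → 1) (λ _ → ℕ.≤-refl)) (ℕ.n≤1+n k-1))
         (ℕ.≤-trans (∑-mono k-1 (λ i _ → drop (ι i))) (drop (λ i → ∑< k (ι i))))) ⟩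
  k ℕ.+ (k ℕ.+ inner k)
    ≡⟨ ℕ.+-assoc k k (inner k) ⟨
  k ℕ.+ k ℕ.+ inner k
    ≡⟨ ℕ.+-comm (k ℕ.+ k) (inner k) ⟩
  inner k ℕ.+ (k ℕ.+ k) ∎
  where
  open ℕ.≤-Reasoning
  o ι : ℕ → ℕ → ℕ
  o i j = [ suc (i ℕ.* i ℕ.+ j ℕ.* j) ≤ k ℕ.* k ]
  ι i j = [ suc i ℕ.* suc i ℕ.+ suc j ℕ.* suc j ≤ k ℕ.* k ]
  ones : ∀ n f → (∀ i → f i ℕ.≤ 1) → ∑< n f ℕ.≤ n
  ones n f h = ℕ.≤-trans (∑-mono n (λ i _ → h i))
                         (ℕ.≤-reflexive (trans (∑-const n 1) (ℕ.*-identityʳ n)))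
  drop : ∀ f → ∑< k-1 f ℕ.≤ ∑< k f
  drop f = ℕ.≤-trans (ℕ.m≤m+n _ (f k-1)) (ℕ.≤-reflexive (sym (∑-last k-1 f)))

innerArea : (k : ℕ) .{{_ : NonZero k}} → ℚ
innerArea k@(suc _) = (+ inner k) ℚ./ (k ℕ.* k)

mesh : (k : ℕ) .{{_ : NonZero k}} → ℚ
mesh k@(suc _) = (+ (k ℕ.+ k)) ℚ./ (k ℕ.* k)

innerArea-≤ : ∀ m n .{{_ : NonZero m}} .{{_ : NonZero n}} →
              innerArea m ℚ.≤ innerArea n ℚ.+ mesh n
innerArea-≤ m@(suc _) n@(suc _) = ℚ.≤-trans
  (/-mono (inner m) (m ℕ.* m) (inner n ℕ.+ (n ℕ.+ n)) (n ℕ.* n) le)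
  (ℚ.≤-reflexive (/-+ (inner n) (n ℕ.+ n) (n ℕ.* n)))
  where
  le : inner m ℕ.* (n ℕ.* n) ℕ.≤ (inner n ℕ.+ (n ℕ.+ n)) ℕ.* (m ℕ.* m)
  le = begin
    inner m ℕ.* (n ℕ.* n)                     ≡⟨ ℕ.*-comm (inner m) (n ℕ.* n) ⟩
    (n ℕ.* n) ℕ.* inner m                     ≤⟨ inner≤outer m n ⟩
    (m ℕ.* m) ℕ.* outer n                     ≤⟨ ℕ.*-monoʳ-≤ (m ℕ.* m) (outer≤inner n) ⟩
    (m ℕ.* m) ℕ.* (inner n ℕ.+ (n ℕ.+ n))     ≡⟨ ℕ.*-comm (m ℕ.* m) _ ⟩
    (inner n ℕ.+ (n ℕ.+ n)) ℕ.* (m ℕ.* m)     ∎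
    where open ℕ.≤-Reasoning

mesh-small : ∀ ε → 0ℚ ℚ.< ε → ∃[ N ] (∀ n → N ℕ.≤ n → mesh (suc n) ℚ.≤ ε)
mesh-small (mkℚ (+ 0) _ _)        (*<* (ℤ.+<+ ()))
mesh-small (mkℚ -[1+ _ ] _ _)     (*<* ())
mesh-small ε@(mkℚ +[1+ p ] d-1 _) _ = d ℕ.+ d , λ n N≤n →
  ℚ.≤-trans (/-mono (suc n ℕ.+ suc n) (suc n ℕ.* suc n) (suc p) d (le (suc n) (ℕ.m≤n⇒m≤1+n N≤n)))
            (ℚ.≤-reflexive (ℚ.↥p/↧p≡p ε))
  where
  d : ℕ
  d = suc d-1
  le : ∀ k → d ℕ.+ d ℕ.≤ k → (k ℕ.+ k) ℕ.* d ℕ.≤ suc p ℕ.* (k ℕ.* k)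
  le k h = begin
    (k ℕ.+ k) ℕ.* d       ≡⟨ solve 2 (λ k d → (k :+ k) :* d := (d :+ d) :* k) refl k d ⟩
    (d ℕ.+ d) ℕ.* k       ≤⟨ ℕ.*-monoˡ-≤ k h ⟩
    k ℕ.* k               ≤⟨ ℕ.m≤m+n (k ℕ.* k) _ ⟩
    suc p ℕ.* (k ℕ.* k)   ∎
    where open ℕ.≤-Reasoning
          open ℕSolver

-- The area of { (x , y) ∣ x ≥ 0, y ≥ 0, x² + y² ≤ 1 }, as the limit of the
-- total areas of the squares contained in it.

quarterDiscArea : ℝ
quarterDiscArea .seq n = (+ inner (suc n)) ℚ./ (suc n ℕ.* suc n)
quarterDiscArea .cauchy ε 0<ε with mesh-small ε 0<ε
... | N , h = N , λ m n p q →
  abs-intro (innerArea (suc m)) (innerArea (suc n))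
    (ℚ.≤-trans (innerArea-≤ (suc m) (suc n)) (ℚ.+-monoʳ-≤ (innerArea (suc n)) (h n q)))
    (ℚ.≤-trans (innerArea-≤ (suc n) (suc m)) (ℚ.+-monoʳ-≤ (innerArea (suc m)) (h m p)))

-- π is the area of the unit disc, which the coordinate axes cut into four
-- congruent quarters.

π : ℝ
π = (+ 4 ℚ./ 1) ·ᵣ quarterDiscArea

-- The proofs are irrelevant, so partitions with the same parts are equal.

record Partition : Set where
  constructor mkPartition
  field
    parts          : List ℕ
    .nonIncreasing : Linked ℕ._≥_ parts
    .positive      : All NonZero parts

open Partition public using (parts)

𝒫₂ℤ : Set
𝒫₂ℤ = [ p ∈ Partition ∣ All (2 ∣_) (parts p) ]

n[_] : Partition → ℕ
n[ p ] = product (parts p)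

1/n²[_] : Partition → ℝ
1/n²[ p@(mkPartition _ _ positive) ] =
  fromℚ (ℚ._/_ (+ 1) (n[ p ] ℕ.^ 2) {{ℕ.m^n≢0 n[ p ] 2 {{product≢0 positive}}}})

{-# OPTIONS --safe #-}

-- The partitions with all parts even and at most 2m have
-- Σ 1/n_λ² = ∏_{j≤m} (1 − 1/(2j)²)⁻¹ = W m, a partial Wallis product. That W m
-- tends to twice the area of the quarter disc is Wästlund's argument: with
-- a_n = (1·3⋯(2n−1))/(2·4⋯2n) and s_n = a_0 + ⋯ + a_{n−1}, the convolution
-- identity Σ_{i+j=n} a_i a_j = 1 gives the staircase
-- ⋃_{i+j<n} [s_i , s_{i+1}] × [s_j , s_{j+1}] the area n. It lies in the quarter
-- disc of radius s_{n+1} and contains the one of radius s_{n−1}, while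
-- s_{n+1}² = (2n+1)/W n.

module Submission where

open import Defs
open import Data.Rational using (½)
open import Data.Refinement using (value)

open import Data.Integer.Base as ℤ using (+_)
import Data.Integer.Properties as ℤ
open import Data.Irrelevant using () renaming ([_] to irr)
open import Data.List.Base as List using (List; []; _∷_; _++_; length)
open import Data.List.Extrema.Nat using (max; xs≤max)
open import Data.List.Membership.Propositional using (_∈_)
open import Data.List.Membership.Propositional.Properties using (∈-++⁺ˡ; ∈-++⁺ʳ; ∈-map⁺; ∈-map⁻; ∈-∃++)
open import Data.List.Properties using (∷-injectiveʳ)
open import Data.List.Relation.Binary.Subset.Propositional using (_⊆_)
open import Data.List.Relation.Binary.Subset.Propositional.Properties using (map⁺)
open import Data.List.Relation.Unary.All as All using (All; []; _∷_)
import Data.List.Relation.Unary.All.Properties as All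
open import Data.List.Relation.Unary.AllPairs using ([]; _∷_)
open import Data.List.Relation.Unary.Any using (here; there)
open import Data.List.Relation.Unary.Linked as Linked using (Linked; []; [-]; _∷_)
open import Data.List.Relation.Unary.Linked.Properties using (Linked⇒All)
open import Data.List.Relation.Unary.Unique.Propositional using (Unique)
import Data.List.Relation.Unary.Unique.Propositional.Properties as Unique
open import Data.Nat.Base as ℕ using (ℕ; zero; suc; z≤n; s≤s)
open import Data.Nat.Divisibility using (_∣_; _∣?_; divides)
open import Data.Nat.ListAction using (product)
open import Data.Nat.ListAction.Properties using (product≢0)
import Data.Nat.Properties as ℕ
open import Data.Product.Base using (∃-syntax; _×_; _,_; proj₁; proj₂)
open import Data.Rational hiding (truncate)
import Data.Rational.Properties as ℚ
open import Data.Rational.Solver using (module +-*-Solver)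
import Data.Rational.Unnormalised as ℚᵘ
import Data.Rational.Unnormalised.Properties as ℚᵘ
open import Data.Refinement using () renaming (_,_ to _,ᵣ_)
open import Data.Sum.Base using (inj₁; inj₂)
open import Function.Base using (_∘_)
open import Relation.Binary.Definitions using (tri<; tri≈; tri>)
open import Relation.Binary.PropositionalEquality hiding ([_])
open import Relation.Nullary.Decidable using (yes; no; recompute)
open import Relation.Nullary.Negation using (contradiction)
open +-*-Solver

-- The area of the disc is known only through counts of squares in a k by k grid, so the two
-- containments are never stated as such: staircase and grid are step functions, and their areas are
-- compared as finite rational sums. The scale n of the staircase and the fineness k of the grid
-- stay independent. Scaling the grid to radius `s (suc n)` or `s m` and multiplying by a multiple
-- of W turns the comparisons into n W_n ≤ (2n+1) · (outer area) and (2m)² · (inner area) ≤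
-- (m+1)(2m+1) W_m. They pin W_n to twice the area up to O(1/n), for all k at once up to the mesh of
-- the grid.
--
-- W m is itself an infinite sum, while unordered summation speaks of finite sets. Hence the number
-- of parts is bounded too, by ℓ. Every finite set of partitions lies in such a box, whose sum is at
-- most W m. Conversely a large m, and then an ℓ large in terms of m, bring the box sum close to
-- twice the area, and a finite set containing this box has at least its sum because no term is
-- negative.

*-monoˡ : ∀ {r p q} → 0ℚ ≤ r → p ≤ q → r * p ≤ r * q
*-monoˡ {r} 0≤r = ℚ.*-monoˡ-≤-nonNeg r {{nonNegative 0≤r}}

*-mono : ∀ {p q r s} → 0ℚ ≤ p → 0ℚ ≤ r → p ≤ q → r ≤ s → p * r ≤ q * s
*-mono {p} {q} {r} {s} 0≤p 0≤r p≤q r≤s = ℚ.≤-trans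
  (ℚ.*-monoʳ-≤-nonNeg r {{nonNegative 0≤r}} p≤q)
  (*-monoˡ (ℚ.≤-trans 0≤p p≤q) r≤s)

*-nonNeg : ∀ {p q} → 0ℚ ≤ p → 0ℚ ≤ q → 0ℚ ≤ p * q
*-nonNeg {p} 0≤p 0≤q = ℚ.≤-trans (ℚ.≤-reflexive (sym (ℚ.*-zeroʳ p))) (*-monoˡ 0≤p 0≤q)

+-nonNeg : ∀ {p q} → 0ℚ ≤ p → 0ℚ ≤ q → 0ℚ ≤ p + q
+-nonNeg = ℚ.+-mono-≤

p≤p+q : ∀ {p q} → 0ℚ ≤ q → p ≤ p + q
p≤p+q {p} 0≤q = ℚ.≤-trans (ℚ.≤-reflexive (sym (ℚ.+-identityʳ p))) (ℚ.+-monoʳ-≤ p 0≤q)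

p≤q⇒0≤q-p : ∀ {p q} → p ≤ q → 0ℚ ≤ q - p
p≤q⇒0≤q-p {p} p≤q = ℚ.≤-trans (ℚ.≤-reflexive (sym (ℚ.+-inverseʳ p))) (ℚ.+-monoˡ-≤ (- p) p≤q)

-- Finite sums of rationals.

Σ< : ℕ → (ℕ → ℚ) → ℚ
Σ< zero    f = 0ℚ
Σ< (suc n) f = Σ< n f + f n

Σ<-cong : ∀ n {f g} → (∀ i → i ℕ.< n → f i ≡ g i) → Σ< n f ≡ Σ< n g
Σ<-cong zero    h = refl
Σ<-cong (suc n) h = cong₂ _+_ (Σ<-cong n (λ i i<n → h i (ℕ.m<n⇒m<1+n i<n))) (h n ℕ.≤-refl)

Σ<-mono : ∀ n {f g} → (∀ i → i ℕ.< n → f i ≤ g i) → Σ< n f ≤ Σ< n g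
Σ<-mono zero    h = ℚ.≤-refl
Σ<-mono (suc n) h = ℚ.+-mono-≤ (Σ<-mono n (λ i i<n → h i (ℕ.m<n⇒m<1+n i<n))) (h n ℕ.≤-refl)

Σ<-zero : ∀ n → Σ< n (λ _ → 0ℚ) ≡ 0ℚ
Σ<-zero zero    = refl
Σ<-zero (suc n) = trans (ℚ.+-identityʳ _) (Σ<-zero n)

Σ<-nonNeg : ∀ n {f} → (∀ i → i ℕ.< n → 0ℚ ≤ f i) → 0ℚ ≤ Σ< n f
Σ<-nonNeg n h = ℚ.≤-trans (ℚ.≤-reflexive (sym (Σ<-zero n))) (Σ<-mono n h)

Σ<-+ : ∀ n f g → Σ< n (λ i → f i + g i) ≡ Σ< n f + Σ< n g
Σ<-+ zero    f g = refl
Σ<-+ (suc n) f g = trans (cong (_+ (f n + g n)) (Σ<-+ n f g))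
  (solve 4 (λ a b c d → (a :+ b) :+ (c :+ d) := (a :+ c) :+ (b :+ d)) refl
     (Σ< n f) (Σ< n g) (f n) (g n))

Σ<-*ʳ : ∀ n f c → Σ< n (λ i → f i * c) ≡ Σ< n f * c
Σ<-*ʳ zero    f c = sym (ℚ.*-zeroˡ c)
Σ<-*ʳ (suc n) f c = trans (cong (_+ f n * c) (Σ<-*ʳ n f c)) (sym (ℚ.*-distribʳ-+ c (Σ< n f) (f n)))

Σ<-*ˡ : ∀ n c f → Σ< n (λ i → c * f i) ≡ c * Σ< n f
Σ<-*ˡ n c f = trans (Σ<-cong n (λ i _ → ℚ.*-comm c (f i))) (trans (Σ<-*ʳ n f c) (ℚ.*-comm (Σ< n f) c))

Σ<-swap : ∀ m n (f : ℕ → ℕ → ℚ) → Σ< m (λ i → Σ< n (f i)) ≡ Σ< n (λ j → Σ< m (λ i → f i j))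
Σ<-swap zero    n f = sym (Σ<-zero n)
Σ<-swap (suc m) n f = trans (cong (_+ Σ< n (f m)) (Σ<-swap m n f)) (sym (Σ<-+ n _ (f m)))

Δ : (ℕ → ℚ) → ℕ → ℚ
Δ f i = f (suc i) - f i

Σ<-Δ : ∀ n f → Σ< n (Δ f) ≡ f n - f 0
Σ<-Δ zero    f = sym (ℚ.+-inverseʳ (f 0))
Σ<-Δ (suc n) f = trans (cong (_+ Δ f n) (Σ<-Δ n f))
  (solve 3 (λ a b c → (b :- a) :+ (c :- b) := c :- a) refl (f 0) (f n) (f (suc n)))

Σ<-suc : ∀ n f → Σ< (suc n) f ≡ f 0 + Σ< n (f ∘ suc)
Σ<-suc zero    f = ℚ.+-comm 0ℚ (f 0)
Σ<-suc (suc n) f = trans (cong (_+ f (suc n)) (Σ<-suc n f)) (ℚ.+-assoc (f 0) _ _)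

-- Monotone sequences and integrals of step functions.

Monotone : (ℕ → ℚ) → Set
Monotone f = ∀ i → f i ≤ f (suc i)

Δ-nonNeg : ∀ {f} → Monotone f → ∀ i → 0ℚ ≤ Δ f i
Δ-nonNeg f↗ i = p≤q⇒0≤q-p (f↗ i)

monotone⇒≤ : ∀ {f} → Monotone f → ∀ {i j} → i ℕ.≤ j → f i ≤ f j
monotone⇒≤ {f} f↗ i≤j = go (ℕ.≤⇒≤′ i≤j)
  where
  go : ∀ {i j} → i ℕ.≤′ j → f i ≤ f j
  go ℕ.≤′-refl     = ℚ.≤-refl
  go (ℕ.≤′-step p) = ℚ.≤-trans (go p) (f↗ _)

-- The length of the intersection of [a , b] and [c , d].

∩-length : (a b c d : ℚ) → ℚ
∩-length a b c d = (b ⊓ d - b ⊓ c) - (a ⊓ d - a ⊓ c)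

∩-length-comm : ∀ a b c d → ∩-length a b c d ≡ ∩-length c d a b
∩-length-comm a b c d rewrite ℚ.⊓-comm b d | ℚ.⊓-comm b c | ℚ.⊓-comm a d | ℚ.⊓-comm a c =
  solve 4 (λ x y z w → (x :- y) :- (z :- w) := (x :- z) :- (y :- w)) refl (d ⊓ b) (c ⊓ b) (d ⊓ a) (c ⊓ a)

∩-length-before : ∀ {a b c d} → a ≤ b → c ≤ d → b ≤ c → ∩-length a b c d ≡ 0ℚ
∩-length-before {a} {b} {c} {d} a≤b c≤d b≤c
  rewrite ℚ.p≤q⇒p⊓q≡p (ℚ.≤-trans b≤c c≤d) | ℚ.p≤q⇒p⊓q≡p b≤c
        | ℚ.p≤q⇒p⊓q≡p (ℚ.≤-trans a≤b (ℚ.≤-trans b≤c c≤d)) | ℚ.p≤q⇒p⊓q≡p (ℚ.≤-trans a≤b b≤c) =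
  solve 2 (λ a b → (b :- b) :- (a :- a) := con 0ℚ) refl a b

∩-length-nonNeg : ∀ {a b c d} → a ≤ b → c ≤ d → 0ℚ ≤ ∩-length a b c d
∩-length-nonNeg {a} {b} {c} {d} a≤b c≤d with ℚ.≤-total b c
... | inj₁ b≤c = ℚ.≤-reflexive (sym (∩-length-before a≤b c≤d b≤c))
... | inj₂ c≤b = p≤q⇒0≤q-p (subst (λ x → a ⊓ d - a ⊓ c ≤ b ⊓ d - x) (sym (ℚ.p≥q⇒p⊓q≡q c≤b)) bound)
  where
  bound : a ⊓ d - a ⊓ c ≤ b ⊓ d - c
  bound with ℚ.≤-total a c
  ... | inj₁ a≤c rewrite ℚ.p≤q⇒p⊓q≡p a≤c | ℚ.p≤q⇒p⊓q≡p (ℚ.≤-trans a≤c c≤d) =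
    ℚ.≤-trans (ℚ.≤-reflexive (ℚ.+-inverseʳ a)) (p≤q⇒0≤q-p (ℚ.⊓-glb c≤b c≤d))
  ... | inj₂ c≤a rewrite ℚ.p≥q⇒p⊓q≡q c≤a = ℚ.+-monoˡ-≤ (- c) (ℚ.⊓-monoˡ-≤ d a≤b)

-- `t ⊓ d - t ⊓ c` is the length of the part of [c , d] below t, so `∩-length` is a second
-- difference of `⊓` and telescopes along consecutive intervals. The lower end drops out because y
-- starts at 0 ≤ a.
Σ<-∩-length : ∀ {y : ℕ → ℚ} → y 0 ≡ 0ℚ → ∀ N {a b} → 0ℚ ≤ a → a ≤ b →
             Σ< N (λ p → ∩-length a b (y p) (y (suc p))) ≡ b ⊓ y N - a ⊓ y N
Σ<-∩-length {y} y₀≡0 N {a} {b} 0≤a a≤b = begin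
  Σ< N (λ p → ∩-length a b (y p) (y (suc p)))
    ≡⟨ Σ<-cong N (λ p _ → solve 4 (λ x y z w → (x :- y) :- (z :- w) := (x :- z) :- (y :- w)) refl
         (b ⊓ y (suc p)) (b ⊓ y p) (a ⊓ y (suc p)) (a ⊓ y p)) ⟩
  Σ< N (Δ (λ p → b ⊓ y p - a ⊓ y p))
    ≡⟨ Σ<-Δ N (λ p → b ⊓ y p - a ⊓ y p) ⟩
  (b ⊓ y N - a ⊓ y N) - (b ⊓ y 0 - a ⊓ y 0)
    ≡⟨ cong (λ c → (b ⊓ y N - a ⊓ y N) - c) zero-end ⟩
  (b ⊓ y N - a ⊓ y N) - 0ℚ
    ≡⟨ ℚ.+-identityʳ _ ⟩
  b ⊓ y N - a ⊓ y N ∎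
  where
  open ≡-Reasoning
  zero-end : b ⊓ y 0 - a ⊓ y 0 ≡ 0ℚ
  zero-end = trans
    (cong (λ c → b ⊓ c - a ⊓ c) y₀≡0)
    (cong₂ _-_ (ℚ.p≥q⇒p⊓q≡q (ℚ.≤-trans 0≤a a≤b)) (ℚ.p≥q⇒p⊓q≡q 0≤a))

-- Σ Δx·h and Σ Δy·g are the integrals of the step functions with value h i on
-- [x i , x (suc i)] and g p on [y p , y (suc p)].

step-integral-mono :
  ∀ {x y : ℕ → ℚ} → Monotone x → Monotone y → x 0 ≡ 0ℚ → y 0 ≡ 0ℚ →
  ∀ M N → x M ≤ y N → ∀ {h g : ℕ → ℚ} → (∀ p → p ℕ.< N → 0ℚ ≤ g p) →
  (∀ i p → i ℕ.< M → p ℕ.< N → x i < y (suc p) → y p < x (suc i) → h i ≤ g p) →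
  Σ< M (λ i → Δ x i * h i) ≤ Σ< N (λ p → Δ y p * g p)
step-integral-mono {x} {y} x↗ y↗ x₀≡0 y₀≡0 M N cover {h} {g} 0≤g h≤g = begin
  Σ< M (λ i → Δ x i * h i)
    ≡⟨ Σ<-cong M (λ i i<M → cong (_* h i) (sym (row i i<M))) ⟩
  Σ< M (λ i → Σ< N (λ p → ℓ i p) * h i)
    ≡⟨ Σ<-cong M (λ i _ → sym (Σ<-*ʳ N (ℓ i) (h i))) ⟩
  Σ< M (λ i → Σ< N (λ p → ℓ i p * h i))
    -- The values are compared cell by cell on the common refinement. Where two intervals do not
    -- overlap, the weight ℓ i p is 0, so the pointwise comparison is asked only of overlapping
    -- ones.
    ≤⟨ Σ<-mono M (λ i i<M → Σ<-mono N (λ p p<N → entry i p i<M p<N)) ⟩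
  Σ< M (λ i → Σ< N (λ p → ℓ i p * g p))
    ≡⟨ Σ<-swap M N _ ⟩
  Σ< N (λ p → Σ< M (λ i → ℓ i p * g p))
    ≡⟨ Σ<-cong N (λ p _ → Σ<-*ʳ M (λ i → ℓ i p) (g p)) ⟩
  Σ< N (λ p → Σ< M (λ i → ℓ i p) * g p)
    ≤⟨ Σ<-mono N (λ p p<N → ℚ.*-monoʳ-≤-nonNeg (g p) {{nonNegative (0≤g p p<N)}} (column p)) ⟩
  Σ< N (λ p → Δ y p * g p) ∎
  where
  open ℚ.≤-Reasoning
  ℓ : ℕ → ℕ → ℚ
  ℓ i p = ∩-length (x i) (x (suc i)) (y p) (y (suc p))
  0≤x : ∀ i → 0ℚ ≤ x i
  0≤x i = subst (_≤ x i) x₀≡0 (monotone⇒≤ x↗ z≤n)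
  0≤y : ∀ i → 0ℚ ≤ y i
  0≤y i = subst (_≤ y i) y₀≡0 (monotone⇒≤ y↗ z≤n)
  row : ∀ i → i ℕ.< M → Σ< N (ℓ i) ≡ Δ x i
  row i i<M = trans (Σ<-∩-length {y} y₀≡0 N (0≤x i) (x↗ i))
    (cong₂ _-_ (ℚ.p≤q⇒p⊓q≡p (ℚ.≤-trans (monotone⇒≤ x↗ i<M) cover))
               (ℚ.p≤q⇒p⊓q≡p (ℚ.≤-trans (monotone⇒≤ x↗ (ℕ.<⇒≤ i<M)) cover)))
  -- `row` is an equality because `cover` keeps every x-interval inside [0 , y N]. A y-interval may
  -- stick out beyond x M, so here only an inequality holds, and `0≤g` absorbs the excess.
  column : ∀ p → Σ< M (λ i → ℓ i p) ≤ Δ y p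
  column p = begin
    Σ< M (λ i → ℓ i p)
      ≡⟨ Σ<-cong M (λ i _ → ∩-length-comm (x i) (x (suc i)) (y p) (y (suc p))) ⟩
    Σ< M (λ i → ∩-length (y p) (y (suc p)) (x i) (x (suc i)))
      ≡⟨ Σ<-∩-length {x} x₀≡0 M (0≤y p) (y↗ p) ⟩
    y (suc p) ⊓ x M - y p ⊓ x M
      ≤⟨ clip (x M) (y↗ p) ⟩
    Δ y p ∎
    where
    clip : ∀ {a b} c → a ≤ b → b ⊓ c - a ⊓ c ≤ b - a
    clip {a} {b} c a≤b with ℚ.≤-total a c
    ... | inj₁ a≤c rewrite ℚ.p≤q⇒p⊓q≡p a≤c = ℚ.+-monoˡ-≤ (- a) (ℚ.p⊓q≤p b c)
    ... | inj₂ c≤a rewrite ℚ.p≥q⇒p⊓q≡q c≤a | ℚ.p≥q⇒p⊓q≡q (ℚ.≤-trans c≤a a≤b) =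
      ℚ.≤-trans (ℚ.≤-reflexive (ℚ.+-inverseʳ c)) (p≤q⇒0≤q-p a≤b)
  disjoint : ∀ i p → ℓ i p ≡ 0ℚ → ℓ i p * h i ≤ ℓ i p * g p
  disjoint i p eq rewrite eq = ℚ.≤-reflexive (trans (ℚ.*-zeroˡ (h i)) (sym (ℚ.*-zeroˡ (g p))))
  entry : ∀ i p → i ℕ.< M → p ℕ.< N → ℓ i p * h i ≤ ℓ i p * g p
  entry i p i<M p<N with x i <? y (suc p) | y p <? x (suc i)
  ... | yes lt₁ | yes lt₂ = *-monoˡ (∩-length-nonNeg (x↗ i) (y↗ p)) (h≤g i p i<M p<N lt₁ lt₂)
  ... | yes _   | no nlt  = disjoint i p (∩-length-before (x↗ i) (y↗ p) (ℚ.≮⇒≥ nlt))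
  ... | no nlt  | _       = disjoint i p (trans (∩-length-comm (x i) (x (suc i)) (y p) (y (suc p)))
                                                (∩-length-before (y↗ p) (x↗ i) (ℚ.≮⇒≥ nlt)))

-- Natural numbers and their reciprocals in ℚ.

ι : ℕ → ℚ
ι n = + n / 1

1/suc : ℕ → ℚ
1/suc n = + 1 / suc n

ι-+ : ∀ m n → ι (m ℕ.+ n) ≡ ι m + ι n
ι-+ m n = /-+ m n 1

ι-suc : ∀ n → ι (suc n) ≡ 1ℚ + ι n
ι-suc n = ι-+ 1 n

ι-* : ∀ m n → ι (m ℕ.* n) ≡ ι m * ι n
ι-* zero    n = sym (ℚ.*-zeroˡ (ι n))
ι-* (suc m) n rewrite ι-+ n (m ℕ.* n) | ι-* m n | ι-suc m =
  solve 2 (λ m n → n :+ m :* n := (con 1ℚ :+ m) :* n) refl (ι m) (ι n)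

ι-mono : ∀ {m n} → m ℕ.≤ n → ι m ≤ ι n
ι-mono {m} {n} m≤n = /-mono m 1 n 1 (ℕ.*-monoˡ-≤ 1 m≤n)

ι-nonNeg : ∀ n → 0ℚ ≤ ι n
ι-nonNeg n = ι-mono {0} {n} z≤n

ι-∑ : ∀ n f → ι (∑< n f) ≡ Σ< n (ι ∘ f)
ι-∑ zero    f = refl
ι-∑ (suc n) f = trans (cong ι (∑-last n f)) (trans (ι-+ (∑< n f) (f n)) (cong (_+ ι (f n)) (ι-∑ n f)))

/-cancel : ∀ a b .{{_ : ℕ.NonZero b}} → ι b * (+ a / b) ≡ ι a
/-cancel a b@(suc _) = ℚ.toℚᵘ-injective (begin-equality
  toℚᵘ (ι b * (+ a / b))            ≃⟨ ℚ.toℚᵘ-homo-* (ι b) (+ a / b) ⟩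
  toℚᵘ (ι b) ℚᵘ.* toℚᵘ (+ a / b)    ≃⟨ ℚᵘ.*-cong (ℚ.toℚᵘ-fromℚᵘ (+ b ℚᵘ./ 1)) (ℚ.toℚᵘ-fromℚᵘ (+ a ℚᵘ./ b)) ⟩
  (+ b ℚᵘ./ 1) ℚᵘ.* (+ a ℚᵘ./ b)    ≃⟨ ℚᵘ.*≡* eq ⟩
  + a ℚᵘ./ 1                        ≃⟨ ℚ.toℚᵘ-fromℚᵘ (+ a ℚᵘ./ 1) ⟨
  toℚᵘ (ι a)                        ∎)
  where
  open ℚᵘ.≤-Reasoning
  eq : (+ b ℤ.* + a) ℤ.* + 1 ≡ + a ℤ.* (+ (1 ℕ.* b))
  eq = trans (ℤ.*-identityʳ _) (trans (ℤ.*-comm (+ b) (+ a)) (cong (λ c → + a ℤ.* + c) (sym (ℕ.*-identityˡ b))))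

1/suc-inverse : ∀ n → ι (suc n) * 1/suc n ≡ 1ℚ
1/suc-inverse n = /-cancel 1 (suc n)

*-cancelˡ-ι : ∀ n {p q} → ι (suc n) * p ≡ ι (suc n) * q → p ≡ q
*-cancelˡ-ι n {p} {q} eq = trans (undo p) (trans (cong (1/suc n *_) eq) (sym (undo q)))
  where
  undo : ∀ r → r ≡ 1/suc n * (ι (suc n) * r)
  undo r = trans (sym (trans (cong (_* r) (1/suc-inverse n)) (ℚ.*-identityˡ r)))
    (solve 3 (λ x y r → (x :* y) :* r := y :* (x :* r)) refl (ι (suc n)) (1/suc n) r)

1/suc-nonNeg : ∀ n → 0ℚ ≤ 1/suc n
1/suc-nonNeg n = /-mono 0 1 1 (suc n) z≤n

-- The widths a and their partial sums s.

ι₂ : ℕ → ℚ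
ι₂ n = ι n + ι n

a : ℕ → ℚ
a zero    = 1ℚ
a (suc n) = a n * ((1ℚ + ι₂ n) * 1/suc (suc (n ℕ.+ n)))

s : ℕ → ℚ
s zero    = 0ℚ
s (suc n) = s n + a n

2+ι₂-inverse : ∀ n → (1ℚ + (1ℚ + ι₂ n)) * 1/suc (suc (n ℕ.+ n)) ≡ 1ℚ
2+ι₂-inverse n = trans (cong (_* 1/suc (suc (n ℕ.+ n))) (sym eq)) (1/suc-inverse (suc (n ℕ.+ n)))
  where
  eq : ι (suc (suc (n ℕ.+ n))) ≡ 1ℚ + (1ℚ + ι₂ n)
  eq rewrite ι-suc (suc (n ℕ.+ n)) | ι-suc (n ℕ.+ n) | ι-+ n n = refl

a-nonNeg : ∀ n → 0ℚ ≤ a n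
a-nonNeg zero    = ι-nonNeg 1
a-nonNeg (suc n) = *-nonNeg (a-nonNeg n)
  (*-nonNeg (+-nonNeg (ι-nonNeg 1) (+-nonNeg (ι-nonNeg n) (ι-nonNeg n))) (1/suc-nonNeg (suc (n ℕ.+ n))))

s-mono : Monotone s
s-mono n = p≤p+q (a-nonNeg n)

s-nonNeg : ∀ n → 0ℚ ≤ s n
s-nonNeg n = monotone⇒≤ {s} s-mono {0} {n} z≤n

Δs≡a : ∀ n → Δ s n ≡ a n
Δs≡a n = solve 2 (λ s a → (s :+ a) :- s := a) refl (s n) (a n)

-- (2n+2) a_{n+1} = (2n+1) a_n says that 2n a_n grows by exactly a_n at each step, as s does.
s≡ι₂*a : ∀ n → s n ≡ ι₂ n * a n
s≡ι₂*a zero    = refl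
s≡ι₂*a (suc n) = begin
  s n + a n
    ≡⟨ cong (_+ a n) (s≡ι₂*a n) ⟩
  ι₂ n * a n + a n
    -- The ring solver knows nothing of reciprocals. A factor 1 is inserted, replaced by (2n+2) ·
    -- 1/(2n+2), and what remains is a polynomial identity with the reciprocal as a variable. The
    -- same device recurs below.
    ≡⟨ solve 2 (λ ν a → (ν :+ ν) :* a :+ a := a :* (con 1ℚ :+ (ν :+ ν)) :* con 1ℚ) refl (ι n) (a n) ⟩
  a n * (1ℚ + ι₂ n) * 1ℚ
    ≡⟨ cong (a n * (1ℚ + ι₂ n) *_) (2+ι₂-inverse n) ⟨
  a n * (1ℚ + ι₂ n) * ((1ℚ + (1ℚ + ι₂ n)) * 1/suc (suc (n ℕ.+ n)))
    ≡⟨ solve 3 (λ ν a t → a :* (con 1ℚ :+ (ν :+ ν)) :* ((con 1ℚ :+ (con 1ℚ :+ (ν :+ ν))) :* t)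
                 := ((con 1ℚ :+ ν) :+ (con 1ℚ :+ ν)) :* (a :* ((con 1ℚ :+ (ν :+ ν)) :* t)))
         refl (ι n) (a n) (1/suc (suc (n ℕ.+ n))) ⟩
  ((1ℚ + ι n) + (1ℚ + ι n)) * a (suc n)
    ≡⟨ cong (λ c → (c + c) * a (suc n)) (ι-suc n) ⟨
  ι₂ (suc n) * a (suc n) ∎
  where open ≡-Reasoning

s-suc : ∀ n → s (suc n) ≡ (1ℚ + ι₂ n) * a n
s-suc n = trans (cong (_+ a n) (s≡ι₂*a n))
  (solve 2 (λ ν a → (ν :+ ν) :* a :+ a := (con 1ℚ :+ (ν :+ ν)) :* a) refl (ι n) (a n))

-- Convolutions and the area of the staircase.

-- The Cauchy product coefficient of f and g. Recursion that shifts f keeps truncated subtraction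
-- out of the inductions; `conv≡Σ<` returns to the indexed form.
conv : ℕ → (ℕ → ℚ) → (ℕ → ℚ) → ℚ
conv zero    f g = f 0 * g 0
conv (suc n) f g = f 0 * g (suc n) + conv n (f ∘ suc) g

conv-congˡ : ∀ n {f f′} g → (∀ i → f i ≡ f′ i) → conv n f g ≡ conv n f′ g
conv-congˡ zero    g h = cong (_* g 0) (h 0)
conv-congˡ (suc n) g h = cong₂ _+_ (cong (_* g (suc n)) (h 0)) (conv-congˡ n g (h ∘ suc))

conv-+ˡ : ∀ n f f′ g → conv n (λ i → f i + f′ i) g ≡ conv n f g + conv n f′ g
conv-+ˡ zero    f f′ g = ℚ.*-distribʳ-+ (g 0) (f 0) (f′ 0)
conv-+ˡ (suc n) f f′ g = trans (cong (λ c → (f 0 + f′ 0) * g (suc n) + c) (conv-+ˡ n (f ∘ suc) (f′ ∘ suc) g))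
  (solve 5 (λ x y z u v → (x :+ y) :* z :+ (u :+ v) := (x :* z :+ u) :+ (y :* z :+ v)) refl
    (f 0) (f′ 0) (g (suc n)) (conv n (f ∘ suc) g) (conv n (f′ ∘ suc) g))

conv-last : ∀ n f g → conv (suc n) f g ≡ conv n f (g ∘ suc) + f (suc n) * g 0
conv-last zero    f g = refl
conv-last (suc n) f g = trans (cong (λ c → f 0 * g (suc (suc n)) + c) (conv-last n (f ∘ suc) g))
  (sym (ℚ.+-assoc (f 0 * g (suc (suc n))) (conv n (f ∘ suc) (g ∘ suc)) (f (suc (suc n)) * g 0)))

conv-comm : ∀ n f g → conv n f g ≡ conv n g f
conv-comm zero    f g = ℚ.*-comm (f 0) (g 0)
conv-comm (suc n) f g = begin
  f 0 * g (suc n) + conv n (f ∘ suc) g    ≡⟨ cong₂ _+_ (ℚ.*-comm (f 0) (g (suc n))) (conv-comm n (f ∘ suc) g) ⟩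
  g (suc n) * f 0 + conv n g (f ∘ suc)    ≡⟨ ℚ.+-comm (g (suc n) * f 0) _ ⟩
  conv n g (f ∘ suc) + g (suc n) * f 0    ≡⟨ conv-last n g f ⟨
  conv (suc n) g f                        ∎
  where open ≡-Reasoning

-- Every term has i + j = n. On generating functions this is the product rule for z d/dz.
conv-ι : ∀ n f g → conv n (λ i → ι i * f i) g + conv n f (λ i → ι i * g i) ≡ ι n * conv n f g
conv-ι zero    f g = solve 2 (λ x y → (con 0ℚ :* x) :* y :+ x :* (con 0ℚ :* y) := con 0ℚ :* (x :* y)) refl (f 0) (g 0)
conv-ι (suc n) f g = begin
  (0ℚ * f 0 * g (suc n) + conv n (λ i → ι (suc i) * f (suc i)) g) + (f 0 * (ι (suc n) * g (suc n)) + V)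
    ≡⟨ cong (λ c → (0ℚ * f 0 * g (suc n) + c) + (f 0 * (ι (suc n) * g (suc n)) + V))
         (trans (conv-congˡ n g (λ i → trans (cong (_* f (suc i)) (ι-suc i))
                  (trans (ℚ.*-distribʳ-+ (f (suc i)) 1ℚ (ι i)) (cong (_+ ι i * f (suc i)) (ℚ.*-identityˡ (f (suc i)))))))
                (conv-+ˡ n (f ∘ suc) (λ i → ι i * f (suc i)) g)) ⟩
  (0ℚ * f 0 * g (suc n) + (C + U)) + (f 0 * (ι (suc n) * g (suc n)) + V)
    ≡⟨ solve 6 (λ x y ν c u v → (con 0ℚ :* x :* y :+ (c :+ u)) :+ (x :* (ν :* y) :+ v) := ν :* (x :* y) :+ (c :+ (u :+ v)))
         refl (f 0) (g (suc n)) (ι (suc n)) C U V ⟩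
  ι (suc n) * (f 0 * g (suc n)) + (C + (U + V))
    ≡⟨ cong (λ c → ι (suc n) * (f 0 * g (suc n)) + (C + c)) (conv-ι n (f ∘ suc) g) ⟩
  ι (suc n) * (f 0 * g (suc n)) + (C + ι n * C)
    ≡⟨ cong (λ c → c * (f 0 * g (suc n)) + (C + ι n * C)) (ι-suc n) ⟩
  (1ℚ + ι n) * (f 0 * g (suc n)) + (C + ι n * C)
    ≡⟨ solve 3 (λ ν x c → (con 1ℚ :+ ν) :* x :+ (c :+ ν :* c) := (con 1ℚ :+ ν) :* (x :+ c)) refl (ι n) (f 0 * g (suc n)) C ⟩
  (1ℚ + ι n) * (f 0 * g (suc n) + C)
    ≡⟨ cong (_* (f 0 * g (suc n) + C)) (ι-suc n) ⟨
  ι (suc n) * conv (suc n) f g ∎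
  where
  open ≡-Reasoning
  C U V : ℚ
  C = conv n (f ∘ suc) g
  U = conv n (λ i → ι i * f (suc i)) g
  V = conv n (f ∘ suc) (λ i → ι i * g i)

conv≡Σ< : ∀ n f g → conv n f g ≡ Σ< (suc n) (λ i → f i * g (n ℕ.∸ i))
conv≡Σ< zero    f g = sym (ℚ.+-identityˡ (f 0 * g 0))
conv≡Σ< (suc n) f g = trans (cong (λ c → f 0 * g (suc n) + c) (conv≡Σ< n (f ∘ suc) g))
  (sym (Σ<-suc (suc n) (λ i → f i * g (suc n ℕ.∸ i))))

-- Since s_i = 2i a_i, the left side is two copies of Σ i a_i a_j. Exchanging the indices in one of
-- them gives Σ (i + j) a_i a_j.
conv-s-a : ∀ n → conv n s a ≡ ι n * conv n a a
conv-s-a n = begin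
  conv n s a
    ≡⟨ conv-congˡ n a (λ i → trans (s≡ι₂*a i) (ℚ.*-distribʳ-+ (a i) (ι i) (ι i))) ⟩
  conv n (λ i → ι i * a i + ι i * a i) a
    ≡⟨ conv-+ˡ n ιa ιa a ⟩
  conv n ιa a + conv n ιa a
    ≡⟨ cong (λ c → conv n ιa a + c) (conv-comm n ιa a) ⟩
  conv n ιa a + conv n a ιa
    ≡⟨ conv-ι n a a ⟩
  ι n * conv n a a ∎
  where
  open ≡-Reasoning
  ιa : ℕ → ℚ
  ιa i = ι i * a i

-- Write c_n for the left side. From s_0 = 0 and s_{i+1} = s_i + a_i, `conv-s-a` at n+1 reads (n+1)
-- c_{n+1} = n c_n + c_n, so c is constant. In other words, the generating function of a is (1 -
-- z)^(-1/2).
conv-a-a : ∀ n → conv n a a ≡ 1ℚ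
conv-a-a zero    = refl
conv-a-a (suc n) = trans (*-cancelˡ-ι n (begin
  ι (suc n) * conv (suc n) a a
    ≡⟨ conv-s-a (suc n) ⟨
  0ℚ * a (suc n) + conv n (s ∘ suc) a
    ≡⟨ trans (cong (_+ conv n (s ∘ suc) a) (ℚ.*-zeroˡ (a (suc n)))) (ℚ.+-identityˡ _) ⟩
  conv n (λ i → s i + a i) a
    ≡⟨ conv-+ˡ n s a a ⟩
  conv n s a + conv n a a
    ≡⟨ cong (_+ conv n a a) (conv-s-a n) ⟩
  ι n * conv n a a + conv n a a
    ≡⟨ solve 2 (λ ν c → ν :* c :+ c := (con 1ℚ :+ ν) :* c) refl (ι n) (conv n a a) ⟩
  (1ℚ + ι n) * conv n a a
    ≡⟨ cong (_* conv n a a) (ι-suc n) ⟨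
  ι (suc n) * conv n a a ∎)) (conv-a-a n)
  where open ≡-Reasoning

conv-s-a≡ι : ∀ n → conv n s a ≡ ι n
conv-s-a≡ι n = trans (conv-s-a n) (trans (cong (ι n *_) (conv-a-a n)) (ℚ.*-identityʳ (ι n)))

-- The column over [s_i , s_{i+1}] has the cells j < n - i and thus height s_{n-i}.
staircase-area : ∀ n → Σ< n (λ i → Δ s i * s (n ℕ.∸ i)) ≡ ι n
staircase-area n = begin
  Σ< n (λ i → Δ s i * s (n ℕ.∸ i))
    ≡⟨ Σ<-cong n (λ i _ → cong (_* s (n ℕ.∸ i)) (Δs≡a i)) ⟩
  Σ< n (λ i → a i * s (n ℕ.∸ i))
    ≡⟨ ℚ.+-identityʳ _ ⟨
  Σ< n (λ i → a i * s (n ℕ.∸ i)) + 0ℚ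
    -- The convolution has one more term, i = n, which vanishes because s_0 = 0.
    ≡⟨ cong (λ c → Σ< n (λ i → a i * s (n ℕ.∸ i)) + c) (trans (cong (λ k → a n * s k) (ℕ.n∸n≡0 n)) (ℚ.*-zeroʳ (a n))) ⟨
  Σ< (suc n) (λ i → a i * s (n ℕ.∸ i))
    ≡⟨ conv≡Σ< n a s ⟨
  conv n a s
    ≡⟨ conv-comm n a s ⟩
  conv n s a
    ≡⟨ conv-s-a≡ι n ⟩
  ι n ∎
  where open ≡-Reasoning

-- Distances of the corners of the staircase from the origin.

sq : ℚ → ℚ
sq x = x * x

sq-nonNeg : ∀ {x} → 0ℚ ≤ x → 0ℚ ≤ sq x
sq-nonNeg 0≤x = *-nonNeg 0≤x 0≤x

sq-mono : ∀ {x y} → 0ℚ ≤ x → x ≤ y → sq x ≤ sq y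
sq-mono 0≤x x≤y = *-mono 0≤x 0≤x x≤y x≤y

sq-mono-< : ∀ {x y} → 0ℚ ≤ x → x < y → sq x < sq y
sq-mono-< {x} {y} 0≤x x<y = ℚ.≤-<-trans (*-monoˡ 0≤x (ℚ.<⇒≤ x<y))
  (ℚ.*-monoˡ-<-pos y {{positive (ℚ.≤-<-trans 0≤x x<y)}} x<y)

sq-a-nonNeg : ∀ n → 0ℚ ≤ sq (a n)
sq-a-nonNeg n = sq-nonNeg (a-nonNeg n)

sq-s-increment : ℕ → ℚ
sq-s-increment n = (1ℚ + (ι₂ n + ι₂ n)) * sq (a n)

sq-s-suc : ∀ n → sq (s (suc n)) ≡ sq (s n) + sq-s-increment n
sq-s-suc n rewrite s≡ι₂*a n =
  solve 2 (λ ν a → ((ν :+ ν) :* a :+ a) :* ((ν :+ ν) :* a :+ a)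
                   := ((ν :+ ν) :* a) :* ((ν :+ ν) :* a) :+ (con 1ℚ :+ ((ν :+ ν) :+ (ν :+ ν))) :* (a :* a))
    refl (ι n) (a n)

-- Cleared of denominators this is (4n+5)(2n+1)² = (4n+1)(2n+2)² + 1; the surplus 1 becomes the
-- added square (a_n/(2n+2))².
sq-s-increment-mono : Monotone sq-s-increment
sq-s-increment-mono n = ℚ.≤-trans (p≤p+q (sq-nonNeg (*-nonNeg (a-nonNeg n) (1/suc-nonNeg (suc (n ℕ.+ n)))))) (ℚ.≤-reflexive (begin
  sq-s-increment n + sq (a n * t)
    ≡⟨ solve 3 (λ ν a t → (con 1ℚ :+ ((ν :+ ν) :+ (ν :+ ν))) :* (a :* a) :+ (a :* t) :* (a :* t)
                 := (con 1ℚ :+ ((ν :+ ν) :+ (ν :+ ν))) :* (a :* a) :* (con 1ℚ :* con 1ℚ) :+ (a :* t) :* (a :* t))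
         refl (ι n) (a n) t ⟩
  (1ℚ + (ι₂ n + ι₂ n)) * sq (a n) * sq 1ℚ + sq (a n * t)
    ≡⟨ cong (λ c → (1ℚ + (ι₂ n + ι₂ n)) * sq (a n) * sq c + sq (a n * t)) (2+ι₂-inverse n) ⟨
  (1ℚ + (ι₂ n + ι₂ n)) * sq (a n) * sq ((1ℚ + (1ℚ + ι₂ n)) * t) + sq (a n * t)
    ≡⟨ solve 3 (λ ν a t → (con 1ℚ :+ ((ν :+ ν) :+ (ν :+ ν))) :* (a :* a) :*
                   (((con 1ℚ :+ (con 1ℚ :+ (ν :+ ν))) :* t) :* ((con 1ℚ :+ (con 1ℚ :+ (ν :+ ν))) :* t)) :+ (a :* t) :* (a :* t)
                 := (con 1ℚ :+ (((con 1ℚ :+ ν) :+ (con 1ℚ :+ ν)) :+ ((con 1ℚ :+ ν) :+ (con 1ℚ :+ ν)))) :*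
                    ((a :* ((con 1ℚ :+ (ν :+ ν)) :* t)) :* (a :* ((con 1ℚ :+ (ν :+ ν)) :* t))))
         refl (ι n) (a n) t ⟩
  (1ℚ + (((1ℚ + ι n) + (1ℚ + ι n)) + ((1ℚ + ι n) + (1ℚ + ι n)))) * sq (a (suc n))
    ≡⟨ cong (λ c → (1ℚ + ((c + c) + (c + c))) * sq (a (suc n))) (ι-suc n) ⟨
  sq-s-increment (suc n) ∎))
  where
  open ≡-Reasoning
  t : ℚ
  t = 1/suc (suc (n ℕ.+ n))

-- The sequence s_n² starts at 0 and has growing increments, so j steps gain at least as much from i
-- as from 0. This places the far corner of a cell with i + j < n within distance s_{n+1}.
sq-s-superadditive : ∀ i j → sq (s i) + sq (s j) ≤ sq (s (i ℕ.+ j))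
sq-s-superadditive i zero    = ℚ.≤-reflexive (trans (ℚ.+-identityʳ _) (cong (sq ∘ s) (sym (ℕ.+-identityʳ i))))
sq-s-superadditive i (suc j) = begin
  sq (s i) + sq (s (suc j))
    ≡⟨ cong (λ c → sq (s i) + c) (sq-s-suc j) ⟩
  sq (s i) + (sq (s j) + sq-s-increment j)
    ≡⟨ ℚ.+-assoc (sq (s i)) (sq (s j)) (sq-s-increment j) ⟨
  sq (s i) + sq (s j) + sq-s-increment j
    ≤⟨ ℚ.+-mono-≤ (sq-s-superadditive i j) (monotone⇒≤ {sq-s-increment} sq-s-increment-mono (ℕ.m≤n+m j i)) ⟩
  sq (s (i ℕ.+ j)) + sq-s-increment (i ℕ.+ j)
    ≡⟨ sq-s-suc (i ℕ.+ j) ⟨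
  sq (s (suc (i ℕ.+ j)))
    ≡⟨ cong (sq ∘ s) (ℕ.+-suc i j) ⟨
  sq (s (i ℕ.+ suc j)) ∎
  where open ℚ.≤-Reasoning

-- The reciprocal of the Wallis product W n, see g*W≡1.

g : ℕ → ℚ
g n = (1ℚ + ι₂ n) * sq (a n)

1+ι₂-nonNeg : ∀ n → 0ℚ ≤ 1ℚ + ι₂ n
1+ι₂-nonNeg n = +-nonNeg (ι-nonNeg 1) (+-nonNeg (ι-nonNeg n) (ι-nonNeg n))

g-nonNeg : ∀ n → 0ℚ ≤ g n
g-nonNeg n = *-nonNeg (1+ι₂-nonNeg n) (sq-a-nonNeg n)

-- Comes down to (2n+1)(2n+3) + 1 = (2n+2)².
g-antitone-step : ∀ n → g (suc n) ≤ g n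
g-antitone-step n = ℚ.≤-trans
  (p≤p+q (*-nonNeg (1+ι₂-nonNeg n) (sq-nonNeg (*-nonNeg (a-nonNeg n) (1/suc-nonNeg (suc (n ℕ.+ n)))))))
  (ℚ.≤-reflexive (begin
  g (suc n) + (1ℚ + ι₂ n) * sq (a n * t)
    ≡⟨ cong (λ c → (1ℚ + (c + c)) * sq (a (suc n)) + (1ℚ + ι₂ n) * sq (a n * t)) (ι-suc n) ⟩
  (1ℚ + ((1ℚ + ι n) + (1ℚ + ι n))) * sq (a (suc n)) + (1ℚ + ι₂ n) * sq (a n * t)
    ≡⟨ solve 3 (λ ν a t → (con 1ℚ :+ ((con 1ℚ :+ ν) :+ (con 1ℚ :+ ν))) :*
                    ((a :* ((con 1ℚ :+ (ν :+ ν)) :* t)) :* (a :* ((con 1ℚ :+ (ν :+ ν)) :* t)))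
                    :+ (con 1ℚ :+ (ν :+ ν)) :* ((a :* t) :* (a :* t))
                 := (con 1ℚ :+ (ν :+ ν)) :* (a :* a) :*
                   (((con 1ℚ :+ (con 1ℚ :+ (ν :+ ν))) :* t) :* ((con 1ℚ :+ (con 1ℚ :+ (ν :+ ν))) :* t)))
         refl (ι n) (a n) t ⟩
  (1ℚ + ι₂ n) * sq (a n) * sq ((1ℚ + (1ℚ + ι₂ n)) * t)
    ≡⟨ cong (λ c → (1ℚ + ι₂ n) * sq (a n) * sq c) (2+ι₂-inverse n) ⟩
  (1ℚ + ι₂ n) * sq (a n) * sq 1ℚ
    ≡⟨ ℚ.*-identityʳ _ ⟩
  g n ∎))
  where
  open ≡-Reasoning
  t : ℚ
  t = 1/suc (suc (n ℕ.+ n))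

g-antitone : ∀ {m n} → m ℕ.≤ n → g n ≤ g m
g-antitone m≤n = go (ℕ.≤⇒≤′ m≤n)
  where
  go : ∀ {m n} → m ℕ.≤′ n → g n ≤ g m
  go ℕ.≤′-refl             = ℚ.≤-refl
  go (ℕ.≤′-step {n} m≤′n) = ℚ.≤-trans (g-antitone-step n) (go m≤′n)

sq-s-suc≡g : ∀ n → sq (s (suc n)) ≡ (1ℚ + ι₂ n) * g n
sq-s-suc≡g n = trans (cong sq (s-suc n))
  (solve 2 (λ c a → (c :* a) :* (c :* a) := c :* (c :* (a :* a))) refl (1ℚ + ι₂ n) (a n))

sq-s≤ : ∀ m → sq (s m) ≤ ι₂ m * g m
sq-s≤ m = ℚ.≤-trans
  (p≤p+q (*-nonNeg (+-nonNeg (ι-nonNeg m) (ι-nonNeg m)) (sq-a-nonNeg m)))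
  (ℚ.≤-reflexive (trans (cong (λ c → sq c + ι₂ m * sq (a m)) (s≡ι₂*a m))
    (solve 2 (λ μ a → (μ :* a) :* (μ :* a) :+ μ :* (a :* a) := μ :* ((con 1ℚ :+ μ) :* (a :* a))) refl (ι₂ m) (a m))))

-- Places the near corner of every cell outside the staircase at distance at least s_m. With both
-- indices positive, written i+1 and j+1, and i, j ≤ m, the right side is (2i+1) g_i + (2j+1) g_j ≥
-- (2i+2j+2) g_m ≥ 2m g_m ≥ s_m², as g decreases. In the remaining cases one of the two squares
-- suffices.
sq-s-lower : ∀ m i j → m ℕ.< i ℕ.+ j → sq (s m) ≤ sq (s i) + sq (s j)
sq-s-lower m zero j m<j = ℚ.≤-trans (sq-mono (s-nonNeg m) (monotone⇒≤ {s} s-mono (ℕ.<⇒≤ m<j)))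
  (ℚ.≤-reflexive (sym (ℚ.+-identityˡ _)))
sq-s-lower m (suc i) zero m<i = ℚ.≤-trans
  (sq-mono (s-nonNeg m) (monotone⇒≤ {s} s-mono (ℕ.<⇒≤ (subst (m ℕ.<_) (ℕ.+-identityʳ (suc i)) m<i))))
  (ℚ.≤-reflexive (sym (ℚ.+-identityʳ _)))
sq-s-lower m (suc i) (suc j) m<i+j with i ℕ.≤? m | j ℕ.≤? m
... | no i≰m | _ = ℚ.≤-trans
  (sq-mono (s-nonNeg m) (monotone⇒≤ {s} s-mono (ℕ.m≤n⇒m≤1+n (ℕ.≰⇒≥ i≰m))))
  (p≤p+q (sq-nonNeg (s-nonNeg (suc j))))
... | yes _ | no j≰m = ℚ.≤-trans
  (sq-mono (s-nonNeg m) (monotone⇒≤ {s} s-mono (ℕ.m≤n⇒m≤1+n (ℕ.≰⇒≥ j≰m))))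
  (ℚ.≤-trans (p≤p+q (sq-nonNeg (s-nonNeg (suc i)))) (ℚ.≤-reflexive (ℚ.+-comm (sq (s (suc j))) _)))
... | yes i≤m | yes j≤m = begin
  sq (s m)
    ≤⟨ sq-s≤ m ⟩
  ι₂ m * g m
    ≤⟨ ℚ.*-monoʳ-≤-nonNeg (g m) {{nonNegative (g-nonNeg m)}} (ℚ.+-mono-≤ ιm≤ ιm≤) ⟩
  ((1ℚ + (ι i + ι j)) + (1ℚ + (ι i + ι j))) * g m
    ≡⟨ solve 3 (λ i j g → ((con 1ℚ :+ (i :+ j)) :+ (con 1ℚ :+ (i :+ j))) :* g
                 := (con 1ℚ :+ (i :+ i)) :* g :+ (con 1ℚ :+ (j :+ j)) :* g) refl (ι i) (ι j) (g m) ⟩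
  (1ℚ + ι₂ i) * g m + (1ℚ + ι₂ j) * g m
    ≤⟨ ℚ.+-mono-≤ (*-monoˡ (1+ι₂-nonNeg i) (g-antitone i≤m)) (*-monoˡ (1+ι₂-nonNeg j) (g-antitone j≤m)) ⟩
  (1ℚ + ι₂ i) * g i + (1ℚ + ι₂ j) * g j
    ≡⟨ cong₂ _+_ (sq-s-suc≡g i) (sq-s-suc≡g j) ⟨
  sq (s (suc i)) + sq (s (suc j)) ∎
  where
  open ℚ.≤-Reasoning
  ιm≤ : ι m ≤ 1ℚ + (ι i + ι j)
  ιm≤ = begin
    ι m                  ≤⟨ ι-mono (subst (m ℕ.≤_) (ℕ.+-suc i j) (ℕ.s≤s⁻¹ m<i+j)) ⟩
    ι (suc (i ℕ.+ j))    ≡⟨ ι-suc (i ℕ.+ j) ⟩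
    1ℚ + ι (i ℕ.+ j)     ≡⟨ cong (λ c → 1ℚ + c) (ι-+ i j) ⟩
    1ℚ + (ι i + ι j)     ∎

-- The staircase against the grid.

[≤]≡1 : ∀ {m n} → m ℕ.≤ n → [ m ≤ n ] ≡ 1
[≤]≡1 {m} {n} m≤n = ℕ.≤-antisym ([≤]≤1 m n) ([≤]-mono {0} {0} {m} {n} (λ _ → m≤n))

[≤]≡0 : ∀ {m n} → m ℕ.≰ n → [ m ≤ n ] ≡ 0
[≤]≡0 {m} {n} m≰n = ℕ.n≤0⇒n≡0 ([≤]-mono {m} {n} {1} {0} (λ m≤n → contradiction m≤n m≰n))

-- The k by k grid of the unit square, stretched to [0 , R]²: r is the side of a square and y p the
-- p-th grid line. `integral` turns a count of squares into an area.
module Grid (k′ : ℕ) (R : ℚ) (0≤R : 0ℚ ≤ R) where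
  k : ℕ
  k = suc k′

  r : ℚ
  r = R * 1/suc k′

  y : ℕ → ℚ
  y p = ι p * r

  0≤r : 0ℚ ≤ r
  0≤r = *-nonNeg 0≤R (1/suc-nonNeg k′)

  0≤y : ∀ p → 0ℚ ≤ y p
  0≤y p = *-nonNeg (ι-nonNeg p) 0≤r

  y₀≡0 : y 0 ≡ 0ℚ
  y₀≡0 = ℚ.*-zeroˡ r

  Δy : ∀ p → Δ y p ≡ r
  Δy p = trans (cong (λ c → c * r - y p) (ι-suc p))
    (solve 2 (λ p r → (con 1ℚ :+ p) :* r :- p :* r := r) refl (ι p) r)

  y-mono : Monotone y
  y-mono p = ℚ.*-monoʳ-≤-nonNeg r {{nonNegative 0≤r}} (ι-mono (ℕ.n≤1+n p))

  y-end : y k ≡ R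
  y-end = trans (solve 3 (λ k R t → k :* (R :* t) := R :* (k :* t)) refl (ι k) R (1/suc k′))
    (trans (cong (R *_) (1/suc-inverse k′)) (ℚ.*-identityʳ R))

  sq-y : ∀ p → sq (y p) ≡ ι (p ℕ.* p) * sq r
  sq-y p = trans (solve 2 (λ p r → (p :* r) :* (p :* r) := (p :* p) :* (r :* r)) refl (ι p) r)
    (cong (_* sq r) (sym (ι-* p p)))

  sq-y+sq-y : ∀ p q → sq (y p) + sq (y q) ≡ ι (p ℕ.* p ℕ.+ q ℕ.* q) * sq r
  sq-y+sq-y p q = begin
    sq (y p) + sq (y q)                                ≡⟨ cong₂ _+_ (sq-y p) (sq-y q) ⟩
    ι (p ℕ.* p) * sq r + ι (q ℕ.* q) * sq r            ≡⟨ ℚ.*-distribʳ-+ (sq r) (ι (p ℕ.* p)) (ι (q ℕ.* q)) ⟨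
    (ι (p ℕ.* p) + ι (q ℕ.* q)) * sq r                 ≡⟨ cong (_* sq r) (ι-+ (p ℕ.* p) (q ℕ.* q)) ⟨
    ι (p ℕ.* p ℕ.+ q ℕ.* q) * sq r                     ∎
    where open ≡-Reasoning

  sq-R : sq R ≡ ι (k ℕ.* k) * sq r
  sq-R = trans (cong sq (sym y-end)) (sq-y k)

  ι-sq-mono : ∀ {m n} → m ℕ.≤ n → ι m * sq r ≤ ι n * sq r
  ι-sq-mono m≤n = ℚ.*-monoʳ-≤-nonNeg (sq r) {{nonNegative (sq-nonNeg 0≤r)}} (ι-mono m≤n)

  integral : ∀ (f : ℕ → ℕ → ℕ) →
    Σ< k (λ p → Δ y p * Σ< k (λ q → Δ y q * ι (f p q))) ≡ sq r * ι (∑< k λ p → ∑< k (f p))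
  integral f = begin
    Σ< k (λ p → Δ y p * Σ< k (λ q → Δ y q * ι (f p q)))
      ≡⟨ Σ<-cong k (λ p _ → cong₂ _*_ (Δy p) (trans (Σ<-cong k (λ q _ → cong (_* ι (f p q)) (Δy q)))
           (trans (Σ<-*ˡ k r (ι ∘ f p)) (cong (r *_) (sym (ι-∑ k (f p))))))) ⟩
    Σ< k (λ p → r * (r * ι (∑< k (f p))))
      ≡⟨ Σ<-cong k (λ p _ → sym (ℚ.*-assoc r r (ι (∑< k (f p))))) ⟩
    Σ< k (λ p → sq r * ι (∑< k (f p)))
      ≡⟨ Σ<-*ˡ k (sq r) (λ p → ι (∑< k (f p))) ⟩
    sq r * Σ< k (λ p → ι (∑< k (f p)))
      ≡⟨ cong (sq r *_) (ι-∑ k (λ p → ∑< k (f p))) ⟨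
    sq r * ι (∑< k λ p → ∑< k (f p)) ∎
    where open ≡-Reasoning

-- The staircase is compared with squares of side s_{n+1}/k (resp. s_m/k), one
-- coordinate at a time.

staircase≤outer : ∀ n k′ → ι n ≤ sq (s (suc n) * 1/suc k′) * ι (outer (suc k′))
staircase≤outer n k′ = begin
  ι n
    ≡⟨ staircase-area n ⟨
  Σ< n (λ i → Δ s i * s (n ℕ.∸ i))
    ≤⟨ step-integral-mono {s} {y} s-mono y-mono refl y₀≡0 n k (cover n (ℕ.n≤1+n n))
         {λ i → s (n ℕ.∸ i)} {λ p → Σ< k (λ q → Δ y q * ι (χ p q))}
         (λ p _ → Σ<-nonNeg k (λ q _ → *-nonNeg (Δ-nonNeg {y} y-mono q) (ι-nonNeg (χ p q)))) row ⟩
  Σ< k (λ p → Δ y p * Σ< k (λ q → Δ y q * ι (χ p q)))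
    ≡⟨ integral χ ⟩
  sq r * ι (outer k) ∎
  where
  open ℚ.≤-Reasoning
  open Grid k′ (s (suc n)) (s-nonNeg (suc n))
  χ : ℕ → ℕ → ℕ
  χ p q = [ suc (p ℕ.* p ℕ.+ q ℕ.* q) ≤ k ℕ.* k ]
  cover : ∀ m → m ℕ.≤ suc n → s m ≤ y k
  cover m m≤n = ℚ.≤-trans (monotone⇒≤ {s} s-mono m≤n) (ℚ.≤-reflexive (sym y-end))
  -- The near corner of the square lies strictly below the far corner of a staircase cell, which is
  -- in the disc of radius s_{n+1}.
  cell : ∀ i j p q → i ℕ.< n → j ℕ.< n ℕ.∸ i → y p < s (suc i) → y q < s (suc j) →
         p ℕ.* p ℕ.+ q ℕ.* q ℕ.< k ℕ.* k
  cell i j p q i<n j<n∸i p<i q<j = ℕ.≰⇒> λ k²≤ → ℚ.<-irrefl refl (begin-strict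
    sq (s (suc n))                      ≡⟨ sq-R ⟩
    ι (k ℕ.* k) * sq r                  ≤⟨ ι-sq-mono k²≤ ⟩
    ι (p ℕ.* p ℕ.+ q ℕ.* q) * sq r      ≡⟨ sq-y+sq-y p q ⟨
    sq (y p) + sq (y q)                 <⟨ ℚ.+-mono-< (sq-mono-< (0≤y p) p<i) (sq-mono-< (0≤y q) q<j) ⟩
    sq (s (suc i)) + sq (s (suc j))     ≤⟨ sq-s-superadditive (suc i) (suc j) ⟩
    sq (s (suc i ℕ.+ suc j))            ≤⟨ sq-mono (s-nonNeg (suc i ℕ.+ suc j)) (monotone⇒≤ {s} s-mono (s≤s i+j<n)) ⟩
    sq (s (suc n))                      ∎)
    where
    i+j<n : i ℕ.+ suc j ℕ.≤ n
    i+j<n = ℕ.≤-trans (ℕ.+-monoʳ-≤ i j<n∸i) (ℕ.≤-reflexive (ℕ.m+[n∸m]≡n (ℕ.<⇒≤ i<n)))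
  row : ∀ i p → i ℕ.< n → p ℕ.< k → s i < y (suc p) → y p < s (suc i) →
        s (n ℕ.∸ i) ≤ Σ< k (λ q → Δ y q * ι (χ p q))
  row i p i<n p<k _ p<i = begin
    s (n ℕ.∸ i)
      ≡⟨ ℚ.+-identityʳ _ ⟨
    s (n ℕ.∸ i) - 0ℚ
      ≡⟨ Σ<-Δ (n ℕ.∸ i) s ⟨
    Σ< (n ℕ.∸ i) (Δ s)
      -- Writing the height of the column as an integral of 1 lets the same comparison handle the
      -- second coordinate.
      ≡⟨ Σ<-cong (n ℕ.∸ i) (λ j _ → sym (ℚ.*-identityʳ (Δ s j))) ⟩
    Σ< (n ℕ.∸ i) (λ j → Δ s j * 1ℚ)
      ≤⟨ step-integral-mono {s} {y} s-mono y-mono refl y₀≡0 (n ℕ.∸ i) k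
           (cover (n ℕ.∸ i) (ℕ.m≤n⇒m≤1+n (ℕ.m∸n≤m n i)))
           {λ _ → 1ℚ} {λ q → ι (χ p q)} (λ q _ → ι-nonNeg (χ p q))
           (λ j q j<n∸i _ _ q<j → ℚ.≤-reflexive (cong ι (sym ([≤]≡1 (cell i j p q i<n j<n∸i p<i q<j))))) ⟩
    Σ< k (λ q → Δ y q * ι (χ p q)) ∎

inner≤staircase : ∀ m k′ → sq (s m * 1/suc k′) * ι (inner (suc k′)) ≤ ι (suc m)
inner≤staircase m k′ = begin
  sq r * ι (inner k)
    ≡⟨ integral χ ⟨
  Σ< k (λ p → Δ y p * Σ< k (λ q → Δ y q * ι (χ p q)))
    ≤⟨ step-integral-mono {y} {s} y-mono s-mono y₀≡0 refl k n cover
         {λ p → Σ< k (λ q → Δ y q * ι (χ p q))} {λ i → s (n ℕ.∸ i)}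
         (λ i _ → s-nonNeg (n ℕ.∸ i)) row ⟩
  Σ< n (λ i → Δ s i * s (n ℕ.∸ i))
    ≡⟨ staircase-area n ⟩
  ι n ∎
  where
  open ℚ.≤-Reasoning
  open Grid k′ (s m) (s-nonNeg m)
  n : ℕ
  n = suc m
  χ : ℕ → ℕ → ℕ
  χ p q = [ suc p ℕ.* suc p ℕ.+ suc q ℕ.* suc q ≤ k ℕ.* k ]
  cover : y k ≤ s n
  cover = ℚ.≤-trans (ℚ.≤-reflexive y-end) (s-mono m)
  -- Otherwise the near corner of the staircase cell has distance at least s_m, yet it lies strictly
  -- below the far corner of a square contained in the disc of radius s_m.
  cell : ∀ i j p q → s i < y (suc p) → s j < y (suc q) →
         suc p ℕ.* suc p ℕ.+ suc q ℕ.* suc q ℕ.≤ k ℕ.* k → suc (i ℕ.+ j) ℕ.≤ n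
  cell i j p q i<p j<q ≤k² = ℕ.≰⇒> λ n≤i+j → ℚ.<-irrefl refl (begin-strict
    sq (s m)                                                ≤⟨ sq-s-lower m i j n≤i+j ⟩
    sq (s i) + sq (s j)                                     <⟨ ℚ.+-mono-< (sq-mono-< (s-nonNeg i) i<p) (sq-mono-< (s-nonNeg j) j<q) ⟩
    sq (y (suc p)) + sq (y (suc q))                         ≡⟨ sq-y+sq-y (suc p) (suc q) ⟩
    ι (suc p ℕ.* suc p ℕ.+ suc q ℕ.* suc q) * sq r          ≤⟨ ι-sq-mono ≤k² ⟩
    ι (k ℕ.* k) * sq r                                      ≡⟨ sq-R ⟨
    sq (s m)                                                ∎)
  -- Covering [0 , s_m] takes all n intervals of s, not just the n - i of column i. The height of
  -- the column is therefore expressed by an indicator, which cuts the telescoping sum off at j = n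
  -- - i.
  truncated : ∀ i N → Σ< N (λ j → Δ s j * ι [ suc (i ℕ.+ j) ≤ n ]) ≤ s (n ℕ.∸ i)
  truncated i zero    = s-nonNeg (n ℕ.∸ i)
  truncated i (suc N) with suc (i ℕ.+ N) ℕ.≤? n
  ... | yes i+N<n = begin
    Σ< (suc N) (λ j → Δ s j * ι [ suc (i ℕ.+ j) ≤ n ])
      ≤⟨ Σ<-mono (suc N) (λ j _ → *-monoˡ (Δ-nonNeg {s} s-mono j) (ι-mono ([≤]≤1 (suc (i ℕ.+ j)) n))) ⟩
    Σ< (suc N) (λ j → Δ s j * 1ℚ)
      ≡⟨ Σ<-cong (suc N) (λ j _ → ℚ.*-identityʳ (Δ s j)) ⟩
    Σ< (suc N) (Δ s)
      ≡⟨ Σ<-Δ (suc N) s ⟩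
    s (suc N) - 0ℚ
      ≡⟨ ℚ.+-identityʳ _ ⟩
    s (suc N)
      ≤⟨ monotone⇒≤ {s} s-mono (ℕ.m+n≤o⇒m≤o∸n (suc N) (subst (ℕ._≤ n) (cong suc (ℕ.+-comm i N)) i+N<n)) ⟩
    s (n ℕ.∸ i) ∎
  ... | no i+N≮n = begin
    Σ< N (λ j → Δ s j * ι [ suc (i ℕ.+ j) ≤ n ]) + Δ s N * ι [ suc (i ℕ.+ N) ≤ n ]
      ≡⟨ cong (λ c → Σ< N (λ j → Δ s j * ι [ suc (i ℕ.+ j) ≤ n ]) + c)
           (trans (cong (λ c → Δ s N * ι c) ([≤]≡0 i+N≮n)) (ℚ.*-zeroʳ (Δ s N))) ⟩
    Σ< N (λ j → Δ s j * ι [ suc (i ℕ.+ j) ≤ n ]) + 0ℚ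
      ≡⟨ ℚ.+-identityʳ _ ⟩
    Σ< N (λ j → Δ s j * ι [ suc (i ℕ.+ j) ≤ n ])
      ≤⟨ truncated i N ⟩
    s (n ℕ.∸ i) ∎
  row : ∀ p i → p ℕ.< k → i ℕ.< n → y p < s (suc i) → s i < y (suc p) →
        Σ< k (λ q → Δ y q * ι (χ p q)) ≤ s (n ℕ.∸ i)
  row p i _ _ _ i<p = begin
    Σ< k (λ q → Δ y q * ι (χ p q))
      ≤⟨ step-integral-mono {y} {s} y-mono s-mono y₀≡0 refl k n cover
           {λ q → ι (χ p q)} {λ j → ι [ suc (i ℕ.+ j) ≤ n ]} (λ j _ → ι-nonNeg [ suc (i ℕ.+ j) ≤ n ])
           (λ q j _ _ _ j<q → ι-mono ([≤]-mono (cell i j p q i<p j<q))) ⟩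
    Σ< n (λ j → Δ s j * ι [ suc (i ℕ.+ j) ≤ n ])
      ≤⟨ truncated i n ⟩
    s (n ℕ.∸ i) ∎

-- Wallis products.

1+ι₂-inverse : ∀ n → (1ℚ + ι₂ n) * 1/suc (n ℕ.+ n) ≡ 1ℚ
1+ι₂-inverse n = trans (cong (_* 1/suc (n ℕ.+ n)) (sym eq)) (1/suc-inverse (n ℕ.+ n))
  where
  eq : ι (suc (n ℕ.+ n)) ≡ 1ℚ + ι₂ n
  eq rewrite ι-suc (n ℕ.+ n) | ι-+ n n = refl

3+ι₂-inverse : ∀ n → (1ℚ + (1ℚ + (1ℚ + ι₂ n))) * 1/suc (suc (suc (n ℕ.+ n))) ≡ 1ℚ
3+ι₂-inverse n = trans (cong (_* 1/suc (suc (suc (n ℕ.+ n)))) (sym eq)) (1/suc-inverse (suc (suc (n ℕ.+ n))))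
  where
  eq : ι (suc (suc (suc (n ℕ.+ n)))) ≡ 1ℚ + (1ℚ + (1ℚ + ι₂ n))
  eq rewrite ι-suc (suc (suc (n ℕ.+ n))) | ι-suc (suc (n ℕ.+ n)) | ι-suc (n ℕ.+ n) | ι-+ n n = refl

-- The partial Wallis products ∏_{1≤j≤n} 2j/(2j−1) · 2j/(2j+1).

W : ℕ → ℚ
W zero    = 1ℚ
W (suc n) = W n * (((1ℚ + (1ℚ + ι₂ n)) * 1/suc (n ℕ.+ n)) * ((1ℚ + (1ℚ + ι₂ n)) * 1/suc (suc (suc (n ℕ.+ n)))))

1/even² : ℕ → ℚ
1/even² n = sq (1/suc (suc (n ℕ.+ n)))

W-nonNeg : ∀ n → 0ℚ ≤ W n
W-nonNeg zero    = ι-nonNeg 1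
W-nonNeg (suc n) = *-nonNeg (W-nonNeg n)
  (*-nonNeg (*-nonNeg 0≤2+ι₂ (1/suc-nonNeg (n ℕ.+ n))) (*-nonNeg 0≤2+ι₂ (1/suc-nonNeg (suc (suc (n ℕ.+ n))))))
  where
  0≤2+ι₂ : 0ℚ ≤ 1ℚ + (1ℚ + ι₂ n)
  0≤2+ι₂ = +-nonNeg (ι-nonNeg 1) (1+ι₂-nonNeg n)

1/even²-nonNeg : ∀ n → 0ℚ ≤ 1/even² n
1/even²-nonNeg n = sq-nonNeg (1/suc-nonNeg (suc (n ℕ.+ n)))

-- A subtraction-free form of W_{n+1} (1 - 1/(2n+2)²) = W_n. It mirrors `boxSum-suc`: a partition
-- with parts up to 2n+2 either has no part 2n+2 or is such a partition with one more part 2n+2 in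
-- front.
W-suc : ∀ n → W (suc n) ≡ W n + 1/even² n * W (suc n)
W-suc n = begin
  W n * ((c * u) * (c * w))
    ≡⟨ solve 4 (λ W b u w → let c = con 1ℚ :+ b in
         W :* ((c :* u) :* (c :* w)) := W :* (b :* u) :* ((con 1ℚ :+ c) :* w) :+ W :* (u :* w) :* (con 1ℚ :* con 1ℚ))
         refl (W n) b u w ⟩
  W n * (b * u) * ((1ℚ + c) * w) + W n * (u * w) * sq 1ℚ
    ≡⟨ cong₂ (λ α β → W n * α * β + W n * (u * w) * sq 1ℚ) (1+ι₂-inverse n) (3+ι₂-inverse n) ⟩
  W n * 1ℚ * 1ℚ + W n * (u * w) * sq 1ℚ
    ≡⟨ cong (λ α → W n * 1ℚ * 1ℚ + W n * (u * w) * sq α) (2+ι₂-inverse n) ⟨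
  W n * 1ℚ * 1ℚ + W n * (u * w) * sq (c * t)
    ≡⟨ solve 5 (λ W c t u w → W :* con 1ℚ :* con 1ℚ :+ W :* (u :* w) :* ((c :* t) :* (c :* t))
                  := W :+ (t :* t) :* (W :* ((c :* u) :* (c :* w)))) refl (W n) c t u w ⟩
  W n + 1/even² n * W (suc n) ∎
  where
  open ≡-Reasoning
  b c t u w : ℚ
  b = 1ℚ + ι₂ n
  c = 1ℚ + b
  t = 1/suc (suc (n ℕ.+ n))
  u = 1/suc (n ℕ.+ n)
  w = 1/suc (suc (suc (n ℕ.+ n)))

W-mono : Monotone W
W-mono n = ℚ.≤-trans (p≤p+q (*-nonNeg (1/even²-nonNeg n) (W-nonNeg (suc n)))) (ℚ.≤-reflexive (sym (W-suc n)))

g*W≡1 : ∀ n → g n * W n ≡ 1ℚ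
g*W≡1 zero    = refl
g*W≡1 (suc n) = begin
  g (suc n) * W (suc n)
    ≡⟨ cong (λ α → (1ℚ + (α + α)) * sq (a (suc n)) * W (suc n)) (ι-suc n) ⟩
  (1ℚ + ((1ℚ + ι n) + (1ℚ + ι n))) * sq (a n * (b * t)) * (W n * ((c * u) * (c * w)))
    ≡⟨ solve 6 (λ ν a W t u w → let b = con 1ℚ :+ (ν :+ ν); c = con 1ℚ :+ b in
         (con 1ℚ :+ ((con 1ℚ :+ ν) :+ (con 1ℚ :+ ν))) :* ((a :* (b :* t)) :* (a :* (b :* t))) :* (W :* ((c :* u) :* (c :* w)))
         := b :* (a :* a) :* W :* ((b :* u) :* ((c :* t) :* (c :* t)) :* ((con 1ℚ :+ c) :* w)))
         refl (ι n) (a n) (W n) t u w ⟩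
  g n * W n * ((b * u) * sq (c * t) * ((1ℚ + c) * w))
    ≡⟨ cong₂ _*_ (g*W≡1 n) (cong₂ _*_ (cong₂ (λ α β → α * sq β) (1+ι₂-inverse n) (2+ι₂-inverse n)) (3+ι₂-inverse n)) ⟩
  1ℚ ∎
  where
  open ≡-Reasoning
  b c t u w : ℚ
  b = 1ℚ + ι₂ n
  c = 1ℚ + b
  t = 1/suc (suc (n ℕ.+ n))
  u = 1/suc (n ℕ.+ n)
  w = 1/suc (suc (suc (n ℕ.+ n)))

-- Wallis products against the area of the quarter disc.

/-sq : ∀ c k′ → + c / (suc k′ ℕ.* suc k′) ≡ sq (1/suc k′) * ι c
/-sq c k′ = *-cancelˡ-ι (k′ ℕ.+ k′ ℕ.* suc k′) (begin
  ι (k ℕ.* k) * (+ c / (k ℕ.* k))      ≡⟨ /-cancel c (k ℕ.* k) ⟩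
  ι c                                  ≡⟨ ℚ.*-identityˡ (ι c) ⟨
  1ℚ * ι c                             ≡⟨ cong (λ α → sq α * ι c) (1/suc-inverse k′) ⟨
  sq (ι k * 1/suc k′) * ι c            ≡⟨ solve 3 (λ k t c → ((k :* t) :* (k :* t)) :* c := (k :* k) :* ((t :* t) :* c)) refl (ι k) (1/suc k′) (ι c) ⟩
  ι k * ι k * (sq (1/suc k′) * ι c)    ≡⟨ cong (_* (sq (1/suc k′) * ι c)) (ι-* k k) ⟨
  ι (k ℕ.* k) * (sq (1/suc k′) * ι c)  ∎)
  where
  open ≡-Reasoning
  k : ℕ
  k = suc k′

outerArea : ℕ → ℚ
outerArea k′ = + outer (suc k′) / (suc k′ ℕ.* suc k′)

outerArea≤ : ∀ k′ → outerArea k′ ≤ seq quarterDiscArea k′ + mesh (suc k′)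
outerArea≤ k′ = ℚ.≤-trans
  (/-mono (outer k) (k ℕ.* k) (inner k ℕ.+ (k ℕ.+ k)) (k ℕ.* k) (ℕ.*-monoˡ-≤ (k ℕ.* k) (outer≤inner k)))
  (ℚ.≤-reflexive (/-+ (inner k) (k ℕ.+ k) (k ℕ.* k)))
  where
  k : ℕ
  k = suc k′

W≤outerArea : ∀ n k′ → ι n * W n ≤ (1ℚ + ι₂ n) * outerArea k′
W≤outerArea n k′ = begin
  ι n * W n
    ≤⟨ ℚ.*-monoʳ-≤-nonNeg (W n) {{nonNegative (W-nonNeg n)}} (staircase≤outer n k′) ⟩
  sq (s (suc n) * t) * ι (outer (suc k′)) * W n
    ≡⟨ solve 4 (λ s t o W → ((s :* t) :* (s :* t)) :* o :* W := (s :* s) :* ((t :* t) :* o) :* W)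
         refl (s (suc n)) t (ι (outer (suc k′))) (W n) ⟩
  sq (s (suc n)) * (sq t * ι (outer (suc k′))) * W n
    ≡⟨ cong₂ (λ α β → α * β * W n) (sq-s-suc≡g n) (sym (/-sq (outer (suc k′)) k′)) ⟩
  (1ℚ + ι₂ n) * g n * outerArea k′ * W n
    ≡⟨ solve 4 (λ c g o W → c :* g :* o :* W := (g :* W) :* (c :* o)) refl (1ℚ + ι₂ n) (g n) (outerArea k′) (W n) ⟩
  (g n * W n) * ((1ℚ + ι₂ n) * outerArea k′)
    ≡⟨ trans (cong (_* ((1ℚ + ι₂ n) * outerArea k′)) (g*W≡1 n)) (ℚ.*-identityˡ _) ⟩
  (1ℚ + ι₂ n) * outerArea k′ ∎
  where
  open ℚ.≤-Reasoning
  t : ℚ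
  t = 1/suc k′

-- `inner≤staircase` times (2m+1) W_m, where s_m² (2m+1) W_m = (2m)² g_m W_m = (2m)².
area≤W : ∀ m k′ → sq (ι₂ m) * seq quarterDiscArea k′ ≤ (1ℚ + ι m) * ((1ℚ + ι₂ m) * W m)
area≤W m k′ = begin
  sq (ι₂ m) * A
    ≡⟨ ℚ.*-identityʳ _ ⟨
  sq (ι₂ m) * A * 1ℚ
    ≡⟨ cong (λ α → sq (ι₂ m) * A * α) (g*W≡1 m) ⟨
  sq (ι₂ m) * A * (g m * W m)
    ≡⟨ cong (λ α → sq (ι₂ m) * α * (g m * W m)) (/-sq (inner (suc k′)) k′) ⟩
  sq (ι₂ m) * (sq t * ι (inner (suc k′))) * (g m * W m)
    ≡⟨ solve 5 (λ μ t i a W → ((μ :* μ) :* ((t :* t) :* i)) :* ((con 1ℚ :+ μ) :* (a :* a) :* W)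
         := (((μ :* a) :* t) :* ((μ :* a) :* t)) :* i :* ((con 1ℚ :+ μ) :* W))
         refl (ι₂ m) t (ι (inner (suc k′))) (a m) (W m) ⟩
  sq ((ι₂ m * a m) * t) * ι (inner (suc k′)) * ((1ℚ + ι₂ m) * W m)
    ≡⟨ cong (λ α → sq (α * t) * ι (inner (suc k′)) * ((1ℚ + ι₂ m) * W m)) (s≡ι₂*a m) ⟨
  sq (s m * t) * ι (inner (suc k′)) * ((1ℚ + ι₂ m) * W m)
    ≤⟨ ℚ.*-monoʳ-≤-nonNeg ((1ℚ + ι₂ m) * W m) {{nonNegative (*-nonNeg (1+ι₂-nonNeg m) (W-nonNeg m))}} (inner≤staircase m k′) ⟩
  ι (suc m) * ((1ℚ + ι₂ m) * W m)
    ≡⟨ cong (_* ((1ℚ + ι₂ m) * W m)) (ι-suc m) ⟩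
  (1ℚ + ι m) * ((1ℚ + ι₂ m) * W m) ∎
  where
  open ℚ.≤-Reasoning
  A t : ℚ
  A = seq quarterDiscArea k′
  t = 1/suc k′

*-cancelˡ-≤-ι : ∀ n {p q} → ι (suc n) * p ≤ ι (suc n) * q → p ≤ q
*-cancelˡ-≤-ι n = ℚ.*-cancelˡ-≤-pos (ι (suc n)) {{ℚ.normalize-pos (suc n) 1}}

W≤3 : ∀ n → W n ≤ ι 3
W≤3 zero    = ι-mono {1} {3} (s≤s z≤n)
W≤3 (suc n) = *-cancelˡ-≤-ι n (begin
  -- The grid with a single square, whose outer area is 1, already gives a bound uniform in n.
  ι (suc n) * W (suc n)                ≤⟨ W≤outerArea (suc n) 0 ⟩
  (1ℚ + ι₂ (suc n)) * 1ℚ               ≡⟨ ℚ.*-identityʳ _ ⟩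
  1ℚ + ι₂ (suc n)                      ≤⟨ ℚ.+-monoˡ-≤ (ι₂ (suc n)) (ι-mono {1} {suc n} (s≤s z≤n)) ⟩
  ι (suc n) + ι₂ (suc n)               ≡⟨ solve 1 (λ ν → ν :+ (ν :+ ν) := ν :* con (ι 3)) refl (ι (suc n)) ⟩
  ι (suc n) * ι 3                      ∎)
  where open ℚ.≤-Reasoning

-- (2n+1) W_n = 2 (n W_n) + W_n, with `W≤outerArea` for the first summand and `W≤3` for the second.
W≤2outerArea : ∀ n k′ → W n ≤ ι 2 * outerArea k′ + ι 3 * 1/suc (n ℕ.+ n)
W≤2outerArea n k′ = begin
  W n
    ≡⟨ ℚ.*-identityʳ (W n) ⟨
  W n * 1ℚ
    ≡⟨ cong (W n *_) (1+ι₂-inverse n) ⟨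
  W n * ((1ℚ + ι₂ n) * u)
    ≡⟨ solve 3 (λ ν W u → W :* ((con 1ℚ :+ (ν :+ ν)) :* u) := (con (ι 2) :* (ν :* W) :+ W) :* u) refl (ι n) (W n) u ⟩
  (ι 2 * (ι n * W n) + W n) * u
    ≤⟨ ℚ.*-monoʳ-≤-nonNeg u {{nonNegative (1/suc-nonNeg (n ℕ.+ n))}}
         (ℚ.+-mono-≤ (*-monoˡ (ι-nonNeg 2) (W≤outerArea n k′)) (W≤3 n)) ⟩
  (ι 2 * ((1ℚ + ι₂ n) * outerArea k′) + ι 3) * u
    ≡⟨ solve 3 (λ b O u → (con (ι 2) :* (b :* O) :+ con (ι 3)) :* u := con (ι 2) :* O :* (b :* u) :+ con (ι 3) :* u)
         refl (1ℚ + ι₂ n) (outerArea k′) u ⟩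
  ι 2 * outerArea k′ * ((1ℚ + ι₂ n) * u) + ι 3 * u
    ≡⟨ cong (λ α → ι 2 * outerArea k′ * α + ι 3 * u) (1+ι₂-inverse n) ⟩
  ι 2 * outerArea k′ * 1ℚ + ι 3 * u
    ≡⟨ cong (_+ ι 3 * u) (ℚ.*-identityʳ (ι 2 * outerArea k′)) ⟩
  ι 2 * outerArea k′ + ι 3 * u ∎
  where
  open ℚ.≤-Reasoning
  u : ℚ
  u = 1/suc (n ℕ.+ n)

-- With μ = m+1 the factor left by `area≤W` is (1+μ)(1+2μ)/(2μ²) = 1 + (1+3μ)/(2μ²). Since 1 ≤ μ and
-- W ≤ 3, the excess is at most (4μ/2μ²) · 3 = 6/μ.
2area≤W : ∀ m k′ → ι 2 * seq quarterDiscArea k′ ≤ W (suc m) + ι 6 * 1/suc m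
2area≤W m k′ = begin
  ι 2 * A
    ≡⟨ solve 1 (λ A → con (ι 2) :* A := con (ι 2) :* A :* (con 1ℚ :* con 1ℚ)) refl A ⟩
  ι 2 * A * sq 1ℚ
    ≡⟨ cong (λ α → ι 2 * A * sq α) (1/suc-inverse m) ⟨
  ι 2 * A * sq (μ * t)
    ≡⟨ solve 3 (λ A μ t → con (ι 2) :* A :* ((μ :* t) :* (μ :* t)) := con ½ :* ((μ :+ μ) :* (μ :+ μ) :* A) :* (t :* t)) refl A μ t ⟩
  ½ * (sq (ι₂ (suc m)) * A) * sq t
    ≤⟨ ℚ.*-monoʳ-≤-nonNeg (sq t) {{nonNegative (sq-nonNeg (1/suc-nonNeg m))}} (*-monoˡ {½} (/-mono 0 1 1 2 z≤n) (area≤W (suc m) k′)) ⟩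
  ½ * ((1ℚ + μ) * ((1ℚ + ι₂ (suc m)) * V)) * sq t
    ≡⟨ solve 3 (λ μ V t → con ½ :* ((con 1ℚ :+ μ) :* ((con 1ℚ :+ (μ :+ μ)) :* V)) :* (t :* t)
         := ((μ :* t) :* (μ :* t)) :* V :+ con ½ :* (con 1ℚ :+ con (ι 3) :* μ) :* V :* (t :* t)) refl μ V t ⟩
  sq (μ * t) * V + ½ * (1ℚ + ι 3 * μ) * V * sq t
    ≤⟨ ℚ.+-monoʳ-≤ (sq (μ * t) * V) (ℚ.*-monoʳ-≤-nonNeg (sq t) {{nonNegative (sq-nonNeg (1/suc-nonNeg m))}}
         (*-mono (*-nonNeg 0≤½ (+-nonNeg (ι-nonNeg 1) (*-nonNeg (ι-nonNeg 3) (ι-nonNeg (suc m))))) (W-nonNeg (suc m))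
            (*-monoˡ 0≤½ (ℚ.+-monoˡ-≤ (ι 3 * μ) (ι-mono {1} {suc m} (s≤s z≤n)))) (W≤3 (suc m)))) ⟩
  sq (μ * t) * V + ½ * (μ + ι 3 * μ) * ι 3 * sq t
    ≡⟨ solve 3 (λ μ V t → ((μ :* t) :* (μ :* t)) :* V :+ con ½ :* (μ :+ con (ι 3) :* μ) :* con (ι 3) :* (t :* t)
         := ((μ :* t) :* (μ :* t)) :* V :+ con (ι 6) :* t :* (μ :* t)) refl μ V t ⟩
  sq (μ * t) * V + ι 6 * t * (μ * t)
    ≡⟨ cong (λ α → sq α * V + ι 6 * t * α) (1/suc-inverse m) ⟩
  sq 1ℚ * V + ι 6 * t * 1ℚ
    ≡⟨ cong₂ _+_ (ℚ.*-identityˡ V) (ℚ.*-identityʳ (ι 6 * t)) ⟩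
  V + ι 6 * t ∎
  where
  open ℚ.≤-Reasoning
  0≤½ : 0ℚ ≤ ½
  0≤½ = /-mono 0 1 1 2 z≤n
  A V μ t : ℚ
  A = seq quarterDiscArea k′
  V = W (suc m)
  μ = ι (suc m)
  t = 1/suc m

1/suc-small : ∀ c ε → 0ℚ < ε → ∃[ N ] (∀ n → N ℕ.≤ n → ι c * 1/suc n ≤ ε)
-- Dividing ε by `suc c` instead of `c` admits c = 0.
1/suc-small c ε 0<ε with mesh-small (1/suc c * ε)
  (subst (_< 1/suc c * ε) (ℚ.*-zeroʳ (1/suc c)) (ℚ.*-monoʳ-<-pos (1/suc c) {{ℚ.normalize-pos 1 (suc c)}} 0<ε))
... | N , h = N , λ n N≤n → begin
  ι c * 1/suc n                ≤⟨ *-mono (ι-nonNeg c) (1/suc-nonNeg n) (ι-mono (ℕ.n≤1+n c)) (ℚ.≤-trans (1/suc≤mesh n) (h n N≤n)) ⟩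
  ι (suc c) * (1/suc c * ε)    ≡⟨ ℚ.*-assoc (ι (suc c)) (1/suc c) ε ⟨
  ι (suc c) * 1/suc c * ε      ≡⟨ cong (_* ε) (1/suc-inverse c) ⟩
  1ℚ * ε                       ≡⟨ ℚ.*-identityˡ ε ⟩
  ε                            ∎
  where
  open ℚ.≤-Reasoning
  1/suc≤mesh : ∀ n → 1/suc n ≤ mesh (suc n)
  1/suc≤mesh n = /-mono 1 (suc n) (suc n ℕ.+ suc n) (suc n ℕ.* suc n)
    (ℕ.≤-trans (ℕ.≤-reflexive (ℕ.*-identityˡ _)) (ℕ.*-monoˡ-≤ (suc n) (ℕ.m≤m+n (suc n) (suc n))))

-- Sums over finite sets and the weight of a list of parts.

Σ∈ : ∀ {ℓ} {A : Set ℓ} → (A → ℚ) → List A → ℚ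
Σ∈ f []       = 0ℚ
Σ∈ f (x ∷ xs) = f x + Σ∈ f xs

module _ {ℓ} {A : Set ℓ} {f : A → ℚ} where

  Σ∈-++ : ∀ xs ys → Σ∈ f (xs ++ ys) ≡ Σ∈ f xs + Σ∈ f ys
  Σ∈-++ []       ys = sym (ℚ.+-identityˡ _)
  Σ∈-++ (x ∷ xs) ys = trans (cong (λ c → f x + c) (Σ∈-++ xs ys)) (sym (ℚ.+-assoc (f x) (Σ∈ f xs) (Σ∈ f ys)))

  Σ∈-nonNeg : (∀ x → 0ℚ ≤ f x) → ∀ xs → 0ℚ ≤ Σ∈ f xs
  Σ∈-nonNeg 0≤f []       = ℚ.≤-refl
  Σ∈-nonNeg 0≤f (x ∷ xs) = +-nonNeg (0≤f x) (Σ∈-nonNeg 0≤f xs)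

  -- Deleting one occurrence of the head of xs from ys leaves the tail of xs inside, as the head
  -- does not recur in it.
  Σ∈-⊆ : (∀ x → 0ℚ ≤ f x) → ∀ {xs ys} → Unique xs → xs ⊆ ys → Σ∈ f xs ≤ Σ∈ f ys
  Σ∈-⊆ 0≤f {[]}     {ys} _         _ = Σ∈-nonNeg 0≤f ys
  Σ∈-⊆ 0≤f {x ∷ xs} (x∉xs ∷ uxs) sub with ∈-∃++ (sub (here refl))
  ... | us , vs , refl = begin
    f x + Σ∈ f xs                   ≤⟨ ℚ.+-monoʳ-≤ (f x) (Σ∈-⊆ 0≤f uxs sub′) ⟩
    f x + Σ∈ f (us ++ vs)           ≡⟨ cong (λ c → f x + c) (Σ∈-++ us vs) ⟩
    f x + (Σ∈ f us + Σ∈ f vs)       ≡⟨ solve 3 (λ x u v → x :+ (u :+ v) := u :+ (x :+ v)) refl (f x) (Σ∈ f us) (Σ∈ f vs) ⟩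
    Σ∈ f us + (f x + Σ∈ f vs)       ≡⟨ Σ∈-++ us (x ∷ vs) ⟨
    Σ∈ f (us ++ x ∷ vs)             ∎
    where
    open ℚ.≤-Reasoning
    drop-middle : ∀ {z} us → x ≢ z → z ∈ us ++ x ∷ vs → z ∈ us ++ vs
    drop-middle []       x≢z (here refl) = contradiction refl x≢z
    drop-middle []       x≢z (there z∈)  = z∈
    drop-middle (_ ∷ us) x≢z (here refl) = here refl
    drop-middle (_ ∷ us) x≢z (there z∈)  = there (drop-middle us x≢z z∈)
    sub′ : xs ⊆ us ++ vs
    sub′ z∈xs = drop-middle us (All.lookup x∉xs z∈xs) (sub (there z∈xs))

-- The weight 1/n_λ², with the junk value 0 at non-positive parts.

1/sq : ℕ → ℚ
1/sq zero    = 0ℚ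
1/sq (suc n) = sq (1/suc n)

weight : List ℕ → ℚ
weight []       = 1ℚ
weight (x ∷ xs) = 1/sq x * weight xs

1/sq-nonNeg : ∀ n → 0ℚ ≤ 1/sq n
1/sq-nonNeg zero    = ℚ.≤-refl
1/sq-nonNeg (suc n) = sq-nonNeg (1/suc-nonNeg n)

weight-nonNeg : ∀ xs → 0ℚ ≤ weight xs
weight-nonNeg []       = ι-nonNeg 1
weight-nonNeg (x ∷ xs) = *-nonNeg (1/sq-nonNeg x) (weight-nonNeg xs)

ι-^2 : ∀ n → ι (n ℕ.^ 2) ≡ sq (ι n)
ι-^2 n = trans (cong (λ m → ι (n ℕ.* m)) (ℕ.*-identityʳ n)) (ι-* n n)

weight-product : ∀ xs → All ℕ.NonZero xs → sq (ι (product xs)) * weight xs ≡ 1ℚ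
weight-product []           _         = refl
weight-product (suc n ∷ xs) (_ ∷ pos) = begin
  sq (ι (suc n ℕ.* product xs)) * (sq t * weight xs)
    ≡⟨ cong (λ α → sq α * (sq t * weight xs)) (ι-* (suc n) (product xs)) ⟩
  sq (ι (suc n) * ι (product xs)) * (sq t * weight xs)
    ≡⟨ solve 4 (λ n P t w → ((n :* P) :* (n :* P)) :* ((t :* t) :* w) := ((n :* t) :* (n :* t)) :* ((P :* P) :* w)) refl
         (ι (suc n)) (ι (product xs)) t (weight xs) ⟩
  sq (ι (suc n) * t) * (sq (ι (product xs)) * weight xs)
    ≡⟨ cong₂ (λ α β → sq α * β) (1/suc-inverse n) (weight-product xs pos) ⟩
  1ℚ ∎
  where
  open ≡-Reasoning
  t : ℚ
  t = 1/suc n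

1/≡weight : ∀ xs → All ℕ.NonZero xs → .{{_ : ℕ.NonZero (product xs ℕ.^ 2)}} →
            + 1 / (product xs ℕ.^ 2) ≡ weight xs
1/≡weight xs pos with product xs ℕ.^ 2 | trans (cong (_* weight xs) (ι-^2 (product xs))) (weight-product xs pos)
... | suc N | eq = *-cancelˡ-ι N (trans (/-cancel 1 (suc N)) (sym eq))

-- Finite boxes of even partitions.

-- The partitions with at most ℓ parts, all of them even and at most 2m.

box : ℕ → ℕ → List (List ℕ)
box zero    ℓ       = [] ∷ []
box (suc m) zero    = [] ∷ []
box (suc m) (suc ℓ) = box m (suc ℓ) ++ List.map (suc (suc (m ℕ.+ m)) ∷_) (box (suc m) ℓ)

IsEvenPartition : List ℕ → Set
IsEvenPartition xs = Linked ℕ._≥_ xs × All ℕ.NonZero xs × All (2 ∣_) xs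

2∣2+m+m : ∀ m → 2 ∣ suc (suc (m ℕ.+ m))
2∣2+m+m m = divides (suc m) (cong (λ c → suc (suc c)) (trans (cong (m ℕ.+_) (sym (ℕ.+-identityʳ m))) (ℕ.*-comm 2 m)))

box-bounded : ∀ m ℓ → All (All (ℕ._≤ m ℕ.+ m)) (box m ℓ)
box-bounded zero    ℓ       = [] ∷ []
box-bounded (suc m) zero    = [] ∷ []
box-bounded (suc m) (suc ℓ) = All.++⁺
  (All.map (All.map (λ x≤ → ℕ.≤-trans x≤ (ℕ.+-mono-≤ (ℕ.n≤1+n m) (ℕ.n≤1+n m)))) (box-bounded m (suc ℓ)))
  (All.map⁺ (All.map (ℕ.≤-reflexive (cong suc (sym (ℕ.+-suc m m))) ∷_) (box-bounded (suc m) ℓ)))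

Linked-∷ : ∀ {x xs} → All (ℕ._≤ x) xs → Linked ℕ._≥_ xs → Linked ℕ._≥_ (x ∷ xs)
Linked-∷ []        []         = [-]
Linked-∷ (y≤x ∷ _) ys-linked  = y≤x ∷ ys-linked

box-sound : ∀ m ℓ → All IsEvenPartition (box m ℓ)
box-sound zero    ℓ       = ([] , [] , []) ∷ []
box-sound (suc m) zero    = ([] , [] , []) ∷ []
box-sound (suc m) (suc ℓ) = All.++⁺ (box-sound m (suc ℓ)) (All.map⁺ (All.zipWith cons (box-bounded (suc m) ℓ , box-sound (suc m) ℓ)))
  where
  cons : ∀ {xs} → All (ℕ._≤ suc m ℕ.+ suc m) xs × IsEvenPartition xs → IsEvenPartition (suc (suc (m ℕ.+ m)) ∷ xs)
  cons {xs} (≤2m , linked , pos , even) =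
    Linked-∷ (subst (λ c → All (ℕ._≤ c) xs) (cong suc (ℕ.+-suc m m)) ≤2m) linked , _ ∷ pos , 2∣2+m+m m ∷ even

box-unique : ∀ m ℓ → Unique (box m ℓ)
box-unique zero    ℓ       = [] ∷ []
box-unique (suc m) zero    = [] ∷ []
box-unique (suc m) (suc ℓ) = Unique.++⁺ (box-unique m (suc ℓ)) (Unique.map⁺ ∷-injectiveʳ (box-unique (suc m) ℓ)) disjoint
  where
  disjoint : ∀ {xs} → xs ∈ box m (suc ℓ) × xs ∈ List.map (suc (suc (m ℕ.+ m)) ∷_) (box (suc m) ℓ) → _
  disjoint (xs∈ , xs∈′) with ∈-map⁻ (suc (suc (m ℕ.+ m)) ∷_) xs∈′
  ... | ys , _ , refl = ℕ.<⇒≱ (ℕ.m<n⇒m<1+n ℕ.≤-refl) (All.head (All.lookup (box-bounded m (suc ℓ)) xs∈))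

even-between : ∀ m {x} → 2 ∣ x → x ℕ.≤ suc m ℕ.+ suc m → x ℕ.≰ m ℕ.+ m → x ≡ suc (suc (m ℕ.+ m))
even-between m {x} (divides q refl) x≤ x≰ = trans (q*2≡q+q q) (trans (cong (λ c → c ℕ.+ c) q≡1+m) (cong suc (ℕ.+-suc m m)))
  where
  q*2≡q+q : ∀ q → q ℕ.* 2 ≡ q ℕ.+ q
  q*2≡q+q q = trans (ℕ.*-comm q 2) (cong (q ℕ.+_) (ℕ.+-identityʳ q))
  q≡1+m : q ≡ suc m
  q≡1+m with ℕ.<-cmp q (suc m)
  ... | tri≈ _ eq _ = eq
  ... | tri< q<1+m _ _ = contradiction
    (ℕ.≤-trans (ℕ.≤-reflexive (q*2≡q+q q)) (ℕ.+-mono-≤ (ℕ.s≤s⁻¹ q<1+m) (ℕ.s≤s⁻¹ q<1+m))) x≰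
  ... | tri> _ _ 1+m<q = contradiction x≤
    (ℕ.<⇒≱ (ℕ.<-≤-trans (ℕ.+-mono-< 1+m<q 1+m<q) (ℕ.≤-reflexive (sym (q*2≡q+q q)))))

box-complete : ∀ m ℓ {xs} → IsEvenPartition xs → All (ℕ._≤ m ℕ.+ m) xs → length xs ℕ.≤ ℓ → xs ∈ box m ℓ
box-complete zero    ℓ       {[]}     _ _ _ = here refl
box-complete zero    ℓ       {suc x ∷ xs} _ (() ∷ _) _
box-complete zero    ℓ       {zero ∷ xs} (_ , () ∷ _ , _) _ _
box-complete (suc m) zero    {[]}     _ _ _ = here refl
box-complete (suc m) (suc ℓ) {[]}     p _ _ = ∈-++⁺ˡ (box-complete m (suc ℓ) p [] z≤n)
box-complete (suc m) (suc ℓ) {x ∷ xs} p@(linked , _ ∷ pos , even ∷ evens) (x≤ ∷ xs≤) (s≤s len) with x ℕ.≤? m ℕ.+ m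
-- The head is the largest part, so its bound passes to all parts.
... | yes x≤2m = ∈-++⁺ˡ (box-complete m (suc ℓ) p (Linked⇒All (λ p q → ℕ.≤-trans q p) x≤2m linked) (s≤s len))
... | no  x≰2m = ∈-++⁺ʳ (box m (suc ℓ))
  (subst (λ c → c ∷ xs ∈ List.map (suc (suc (m ℕ.+ m)) ∷_) (box (suc m) ℓ)) (sym (even-between m even x≤ x≰2m))
    (∈-map⁺ (suc (suc (m ℕ.+ m)) ∷_) (box-complete (suc m) ℓ (Linked.tail linked , pos , evens) xs≤ len)))

-- Box sums against Wallis products.

boxSum : ℕ → ℕ → ℚ
boxSum m ℓ = Σ∈ weight (box m ℓ)

Σ∈-weight-∷ : ∀ x xss → Σ∈ weight (List.map (x ∷_) xss) ≡ 1/sq x * Σ∈ weight xss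
Σ∈-weight-∷ x []         = sym (ℚ.*-zeroʳ (1/sq x))
Σ∈-weight-∷ x (xs ∷ xss) = trans (cong (λ c → 1/sq x * weight xs + c) (Σ∈-weight-∷ x xss))
  (sym (ℚ.*-distribˡ-+ (1/sq x) (weight xs) (Σ∈ weight xss)))

boxSum-suc : ∀ m ℓ → boxSum (suc m) (suc ℓ) ≡ boxSum m (suc ℓ) + 1/even² m * boxSum (suc m) ℓ
boxSum-suc m ℓ = trans (Σ∈-++ (box m (suc ℓ)) _)
  (cong (λ c → boxSum m (suc ℓ) + c) (Σ∈-weight-∷ (suc (suc (m ℕ.+ m))) (box (suc m) ℓ)))

boxSum≤W : ∀ m ℓ → boxSum m ℓ ≤ W m
boxSum≤W zero    ℓ       = ℚ.≤-refl
boxSum≤W (suc m) zero    = monotone⇒≤ {W} W-mono {0} {suc m} z≤n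
boxSum≤W (suc m) (suc ℓ) = begin
  boxSum (suc m) (suc ℓ)                       ≡⟨ boxSum-suc m ℓ ⟩
  boxSum m (suc ℓ) + 1/even² m * boxSum (suc m) ℓ   ≤⟨ ℚ.+-mono-≤ (boxSum≤W m (suc ℓ)) (*-monoˡ (1/even²-nonNeg m) (boxSum≤W (suc m) ℓ)) ⟩
  W m + 1/even² m * W (suc m)                       ≡⟨ W-suc m ⟨
  W (suc m)                                    ∎
  where open ℚ.≤-Reasoning

-- This is 3 · 2^m. The 3 is the bound on W, needed at ℓ = 0. The doubling closes the induction of
-- `W≤boxSum`: with c = `boxError m`, v = 1/(ℓ+2), 1/(ℓ+1) ≤ 2v and 1/(2m+2)² ≤ 1/4, the error is at
-- most c v + (2c)(1/4)(2v) = 2c v.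
boxError : ℕ → ℕ
boxError zero    = 3
boxError (suc m) = boxError m ℕ.+ boxError m

3≤boxError : ∀ m → 3 ℕ.≤ boxError m
3≤boxError zero    = ℕ.≤-refl
3≤boxError (suc m) = ℕ.≤-trans (3≤boxError m) (ℕ.m≤m+n (boxError m) (boxError m))

1/suc-halving : ∀ ℓ → 1/suc ℓ ≤ 1/suc (suc ℓ) + 1/suc (suc ℓ)
1/suc-halving ℓ = ℚ.≤-trans (/-mono 1 (suc ℓ) 2 (suc (suc ℓ)) le) (ℚ.≤-reflexive (/-+ 1 1 (suc (suc ℓ))))
  where
  le : 1 ℕ.* suc (suc ℓ) ℕ.≤ 2 ℕ.* suc ℓ
  le = ℕ.≤-trans (ℕ.≤-reflexive (ℕ.*-identityˡ (suc (suc ℓ))))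
    (s≤s (ℕ.≤-trans (ℕ.m≤n+m (suc ℓ) ℓ) (ℕ.≤-reflexive (cong (ℓ ℕ.+_) (sym (ℕ.+-identityʳ (suc ℓ)))))))

1/even²≤¼ : ∀ m → 1/even² m ≤ ½ * ½
1/even²≤¼ m = sq-mono (1/suc-nonNeg (suc (m ℕ.+ m)))
  (/-mono 1 (suc (suc (m ℕ.+ m))) 1 2 (ℕ.≤-trans (s≤s (s≤s z≤n)) (ℕ.≤-reflexive (sym (ℕ.*-identityˡ (suc (suc (m ℕ.+ m))))))))

W≤boxSum : ∀ m ℓ → W m ≤ boxSum m ℓ + ι (boxError m) * 1/suc ℓ
W≤boxSum zero    ℓ       = p≤p+q (*-nonNeg (ι-nonNeg 3) (1/suc-nonNeg ℓ))
W≤boxSum (suc m) zero    = begin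
  W (suc m)                               ≤⟨ W≤3 (suc m) ⟩
  ι 3                                     ≤⟨ ι-mono (3≤boxError (suc m)) ⟩
  ι (boxError (suc m))                    ≡⟨ ℚ.*-identityʳ _ ⟨
  ι (boxError (suc m)) * 1/suc 0          ≤⟨ p≤p+q (ι-nonNeg 1) ⟩
  ι (boxError (suc m)) * 1/suc 0 + 1ℚ     ≡⟨ ℚ.+-comm (ι (boxError (suc m)) * 1/suc 0) 1ℚ ⟩
  1ℚ + ι (boxError (suc m)) * 1/suc 0     ∎
  where open ℚ.≤-Reasoning
W≤boxSum (suc m) (suc ℓ) = begin
  W (suc m)
    ≡⟨ W-suc m ⟩
  W m + 1/even² m * W (suc m)
    ≤⟨ ℚ.+-mono-≤ (W≤boxSum m (suc ℓ)) (*-monoˡ (1/even²-nonNeg m) (W≤boxSum (suc m) ℓ)) ⟩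
  (B + c * v) + 1/even² m * (B′ + ι (boxError (suc m)) * u)
    ≡⟨ cong (λ α → (B + c * v) + 1/even² m * (B′ + α * u)) (ι-+ (boxError m) (boxError m)) ⟩
  (B + c * v) + 1/even² m * (B′ + (c + c) * u)
    ≡⟨ solve 6 (λ B c v x B′ u → (B :+ c :* v) :+ x :* (B′ :+ (c :+ c) :* u) := (B :+ x :* B′) :+ (c :* v :+ (c :+ c) :* (x :* u)))
         refl B c v (1/even² m) B′ u ⟩
  (B + 1/even² m * B′) + (c * v + (c + c) * (1/even² m * u))
    ≤⟨ ℚ.+-monoʳ-≤ (B + 1/even² m * B′) (ℚ.+-monoʳ-≤ (c * v) (*-monoˡ (+-nonNeg (ι-nonNeg (boxError m)) (ι-nonNeg (boxError m)))
         (*-mono (1/even²-nonNeg m) (1/suc-nonNeg ℓ) (1/even²≤¼ m) (1/suc-halving ℓ)))) ⟩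
  (B + 1/even² m * B′) + (c * v + (c + c) * (½ * ½ * (v + v)))
    ≡⟨ solve 3 (λ b c v → b :+ (c :* v :+ (c :+ c) :* (con ½ :* con ½ :* (v :+ v))) := b :+ (c :+ c) :* v) refl (B + 1/even² m * B′) c v ⟩
  (B + 1/even² m * B′) + (c + c) * v
    ≡⟨ cong₂ (λ α β → α + β * v) (boxSum-suc m ℓ) (ι-+ (boxError m) (boxError m)) ⟨
  boxSum (suc m) (suc ℓ) + ι (boxError (suc m)) * v ∎
  where
  open ℚ.≤-Reasoning
  B B′ c u v : ℚ
  B  = boxSum m (suc ℓ)
  B′ = boxSum (suc m) ℓ
  c  = ι (boxError m)
  u  = 1/suc ℓ
  v  = 1/suc (suc ℓ)

-- Passage to the limit.

W-close : ∀ n k′ ε → ι 3 * 1/suc (n ℕ.+ n) ≤ ½ * ε → mesh (suc k′) ≤ ½ * (½ * ε) →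
          W n ≤ ι 2 * seq quarterDiscArea k′ + ε
W-close n k′ ε small mesh≤ = begin
  W n
    ≤⟨ W≤2outerArea n k′ ⟩
  ι 2 * outerArea k′ + ι 3 * 1/suc (n ℕ.+ n)
    ≤⟨ ℚ.+-mono-≤ (*-monoˡ (ι-nonNeg 2) (ℚ.≤-trans (outerArea≤ k′) (ℚ.+-monoʳ-≤ (seq quarterDiscArea k′) mesh≤))) small ⟩
  ι 2 * (seq quarterDiscArea k′ + ½ * (½ * ε)) + ½ * ε
    ≡⟨ solve 2 (λ A ε → con (ι 2) :* (A :+ con ½ :* (con ½ :* ε)) :+ con ½ :* ε := con (ι 2) :* A :+ ε)
         refl (seq quarterDiscArea k′) ε ⟩
  ι 2 * seq quarterDiscArea k′ + ε ∎
  where open ℚ.≤-Reasoning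

-- At the given n the error 3/(2n+1) need not be small. As W increases, n may be replaced by a
-- larger n′ at which it is.
W≤area : ∀ n ε → 0ℚ < ε → ∃[ N ] (∀ k′ → N ℕ.≤ k′ → W n ≤ ι 2 * seq quarterDiscArea k′ + ε)
W≤area n ε 0<ε =
  let M , small = 1/suc-small 3 (½ * ε) (half-pos 0<ε)
      N , mesh≤ = mesh-small (½ * (½ * ε)) (half-pos (half-pos 0<ε))
      n′ = n ℕ.⊔ M
  in N , λ k′ N≤k′ → ℚ.≤-trans (monotone⇒≤ {W} W-mono (ℕ.m≤m⊔n n M))
       (W-close n′ k′ ε (small (n′ ℕ.+ n′) (ℕ.≤-trans (ℕ.m≤n⊔m n M) (ℕ.m≤m+n n′ n′))) (mesh≤ k′ N≤k′))

area-close : ∀ m ℓ k′ ε → ι 6 * 1/suc m ≤ ½ * ε → ι (boxError (suc m)) * 1/suc ℓ ≤ ½ * ε →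
             ι 2 * seq quarterDiscArea k′ ≤ boxSum (suc m) ℓ + ε
area-close m ℓ k′ ε small₁ small₂ = begin
  ι 2 * seq quarterDiscArea k′
    ≤⟨ 2area≤W m k′ ⟩
  W (suc m) + ι 6 * 1/suc m
    ≤⟨ ℚ.+-mono-≤ (ℚ.≤-trans (W≤boxSum (suc m) ℓ) (ℚ.+-monoʳ-≤ (boxSum (suc m) ℓ) small₂)) small₁ ⟩
  (boxSum (suc m) ℓ + ½ * ε) + ½ * ε
    ≡⟨ trans (ℚ.+-assoc (boxSum (suc m) ℓ) (½ * ε) (½ * ε)) (cong (λ c → boxSum (suc m) ℓ + c) (halves ε)) ⟩
  boxSum (suc m) ℓ + ε ∎
  where open ℚ.≤-Reasoning

area≤boxSum : ∀ ε → 0ℚ < ε → ∃[ m ] ∃[ ℓ ] (∀ k′ → ι 2 * seq quarterDiscArea k′ ≤ boxSum m ℓ + ε)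
area≤boxSum ε 0<ε =
  let m , small₁ = 1/suc-small 6 (½ * ε) (half-pos 0<ε)
      -- ℓ comes after m because `boxError` grows exponentially in m.
      ℓ , small₂ = 1/suc-small (boxError (suc m)) (½ * ε) (half-pos 0<ε)
  in suc m , ℓ , λ k′ → area-close m ℓ k′ ε (small₁ m ℕ.≤-refl) (small₂ ℓ ℕ.≤-refl)

-- From lists of parts to partitions and the unordered sum.

evenParts : 𝒫₂ℤ → List ℕ
evenParts p = parts (value p)

evenParts-injective : ∀ {p q} → evenParts p ≡ evenParts q → p ≡ q
evenParts-injective {mkPartition _ _ _ ,ᵣ irr _} {mkPartition _ _ _ ,ᵣ irr _} refl = refl

-- The stored proofs are irrelevant, but all three properties are decidable and can be recomputed.
evenParts-isEvenPartition : ∀ p → IsEvenPartition (evenParts p)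
evenParts-isEvenPartition (mkPartition xs linked pos ,ᵣ irr even) =
  recompute (Linked.linked? ℕ._≥?_ xs) linked ,
  recompute (All.all? ℕ.nonZero? xs) pos ,
  recompute (All.all? (2 ∣?_) xs) even

fromEvenParts : ∀ {xs} → IsEvenPartition xs → 𝒫₂ℤ
fromEvenParts {xs} (linked , pos , even) = mkPartition xs linked pos ,ᵣ irr even

evenParts-fromEvenParts : ∀ {xss} (ps : All IsEvenPartition xss) →
                          List.map evenParts (All.reduce fromEvenParts ps) ≡ xss
evenParts-fromEvenParts []       = refl
evenParts-fromEvenParts (p ∷ ps) = cong (_ ∷_) (evenParts-fromEvenParts ps)

1/n²≡weight : ∀ p k → seq 1/n²[ value p ] k ≡ weight (evenParts p)
1/n²≡weight p@(mkPartition xs _ pos ,ᵣ _) k =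
  1/≡weight xs (proj₁ (proj₂ (evenParts-isEvenPartition p))) {{ℕ.m^n≢0 (product xs) 2 {{product≢0 pos}}}}

seq-sumᵣ : ∀ T k → seq (sumᵣ (List.map (λ p → 1/n²[ value p ]) T)) k ≡ Σ∈ weight (List.map evenParts T)
seq-sumᵣ []      k = refl
seq-sumᵣ (p ∷ T) k = cong₂ _+_ (1/n²≡weight p k) (seq-sumᵣ T k)

⊆-box : ∀ T → ∃[ m ] ∃[ ℓ ] List.map evenParts T ⊆ box m ℓ
⊆-box T = m , ℓ , λ xs∈ → let (p , _ , eq) = ∈-map⁻ evenParts xs∈ in
  box-complete m ℓ (subst IsEvenPartition (sym eq) (evenParts-isEvenPartition p))
    (All.map (λ x≤ → ℕ.≤-trans x≤ (ℕ.≤-trans (All.lookup parts≤ xs∈) (ℕ.m≤m+n m m))) (xs≤max 0 _))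
    (All.lookup length≤ xs∈)
  where
  xss : List (List ℕ)
  xss = List.map evenParts T
  m ℓ : ℕ
  -- A bound on the parts serves as m without halving, since m ≤ 2m.
  m = max 0 (List.map (max 0) xss)
  ℓ = max 0 (List.map length xss)
  parts≤ : All (λ xs → max 0 xs ℕ.≤ m) xss
  parts≤ = All.map⁻ (xs≤max 0 (List.map (max 0) xss))
  length≤ : All (λ xs → length xs ℕ.≤ ℓ) xss
  length≤ = All.map⁻ (xs≤max 0 (List.map length xss))

finite-sum≤W : ∀ T → Unique T → ∃[ m ] Σ∈ weight (List.map evenParts T) ≤ W m
finite-sum≤W T uT with ⊆-box T
... | m , ℓ , T⊆ = m ,
  ℚ.≤-trans (Σ∈-⊆ weight-nonNeg (Unique.map⁺ evenParts-injective uT) T⊆) (boxSum≤W m ℓ)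

corollary2p1 : HasSum {I = 𝒫₂ℤ} (λ p → 1/n²[ value p ]) (½ ·ᵣ π)
corollary2p1 ε 0<ε =
  let m , ℓ , lower = area≤boxSum ε 0<ε
      0≤ε = ℚ.<⇒≤ 0<ε
  -- The lower bound fixes S before T is known. The upper bound holds for every T with the slack δ
  -- from `≤ᵣ`; only its threshold N depends on T.
  in All.reduce fromEvenParts (box-sound m ℓ) , λ T uT S⊆T δ 0<δ →
  let M , T≤W   = finite-sum≤W T uT
      N , upper = W≤area M δ 0<δ
      box⊆T : box m ℓ ⊆ List.map evenParts T
      box⊆T = subst (_⊆ List.map evenParts T) (evenParts-fromEvenParts (box-sound m ℓ)) (map⁺ evenParts S⊆T)
  in N , λ k′ N≤k′ →
  let A = seq quarterDiscArea k′
      Σ = Σ∈ weight (List.map evenParts T)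
      Σ≤ : Σ ≤ ι 2 * A + (ε + δ)
      Σ≤ = ℚ.≤-trans T≤W (ℚ.≤-trans (upper k′ N≤k′) (ℚ.+-monoʳ-≤ (ι 2 * A)
             (ℚ.≤-trans (p≤p+q 0≤ε) (ℚ.≤-reflexive (ℚ.+-comm δ ε)))))
      ≤Σ : ι 2 * A ≤ Σ + (ε + δ)
      ≤Σ = ℚ.≤-trans (lower k′)
             (ℚ.+-mono-≤ (Σ∈-⊆ weight-nonNeg (box-unique m ℓ) box⊆T) (p≤p+q (ℚ.<⇒≤ 0<δ)))
  in subst₂ (λ x y → ∣ x - y ∣ ≤ ε + δ) (sym (seq-sumᵣ T k′))
       -- ½ · π unfolds to ½ · (4 · A), twice the quarter disc.
       (solve 1 (λ A → con (ι 2) :* A := con ½ :* (con (ι 4) :* A)) refl A)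
       (abs-intro Σ (ι 2 * A) Σ≤ ≤Σ)
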